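{- There is a constant $c>0$ such that for each integer $k\ge 50$ there is an infinite class $\mathbf{G}$ of graphs (without isolated vertices), each of treewidth at most $k$, such that for every $G\in\mathbf{G}$ every nondeterministic read-once branching program realizing $\phi(G)$ has size at least $n^{k/c}$, where $n=|V(G)|$ is the number of variables of $\phi(G)$.
   Context: For a graph $G$ with no isolated vertices, $\phi(G)$ is the monotone 2-CNF with variables $\{x_v : v\in V(G)\}$ and clauses $\{(x_u\vee x_v): \{u,v\}\in E(G)\}$; its primal graph is $G$. A nondeterministic read-once branching program (NROBP) realizing a Boolean function $F$ is a connected directed acyclic graph (multiple edges allowed) with one root and one leaf, in which some edges are labelled by literals of variables of $F$ so that no directed path contains two edges labelled by literals of the same variable; writing $A(P)$ for the set of literals labelling edges of a path $P$, it is required that (i) for every root-to-leaf path $P$, every extension of $A(P)$ to a total assignment satisfies $F$, and (ii) for every satisfying assignment $A$ of $F$ there is a root-to-leaf path $P$ with $A(P)\subseteq A$. The size is the number of nodes (equivalently up to constants, edges). Treewidth is the standard graph treewidth. -}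

module Defs where

open import Data.Nat using (ℕ; zero; suc; _≤_; _<_)
open import Data.Fin using (Fin; toℕ; inject₁)
open import Data.Fin.Subset using (Subset; _∈_; ∣_∣)
open import Data.Bool using (Bool; true; false)
open import Data.Maybe using (Maybe; just; nothing)
open import Data.List using (List; []; _∷_; map)
import Data.List.Membership.Propositional as LM
open import Data.List.Relation.Unary.All using (All)
open import Data.List.Relation.Unary.Unique.Propositional using (Unique)
open import Data.Product using (Σ; _×_; _,_; proj₁; ∃)
open import Data.Sum using (_⊎_)
open import Relation.Binary.PropositionalEquality using (_≡_; _≢_)

record Graph (n : ℕ) : Set where
  field
    adj   : Fin n → Fin n → Bool
    sym   : ∀ u v → adj u v ≡ adj v u
    irrefl : ∀ v → adj v v ≡ false
open Graph public

NoIsolatedVertices : ∀ {n} → Graph n → Set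
NoIsolatedVertices {n} G = ∀ (v : Fin n) → Σ (Fin n) λ u → adj G v u ≡ true

-- Tree decompositions and treewidth.
-- A tree on the node set Fin (suc m) is given by a parent map: every node
-- l < m has a parent with strictly larger index; node m is the root.
-- (Every finite tree admits such a labelling.)

TreeAdj : ∀ {m} → (Fin m → Fin (suc m)) → Fin (suc m) → Fin (suc m) → Set
TreeAdj {m} parent a b =
  (Σ (Fin m) λ l → inject₁ l ≡ a × parent l ≡ b) ⊎
  (Σ (Fin m) λ l → inject₁ l ≡ b × parent l ≡ a)

data TreeWalk {m} (parent : Fin m → Fin (suc m)) (Q : Fin (suc m) → Set)
     : Fin (suc m) → Fin (suc m) → Set where
  here : ∀ {a} → TreeWalk parent Q a a
  step : ∀ {a b c} → TreeAdj parent a b → Q b → TreeWalk parent Q b c →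
         TreeWalk parent Q a c

record TreeDecomposition {n : ℕ} (G : Graph n) : Set where
  field
    m         : ℕ
    parent    : Fin m → Fin (suc m)
    parent-up : ∀ l → toℕ (inject₁ l) < toℕ (parent l)
    bag       : Fin (suc m) → Subset n
    vertex-covered : ∀ (v : Fin n) → Σ (Fin (suc m)) λ t → v ∈ bag t
    edge-covered   : ∀ (u v : Fin n) → adj G u v ≡ true →
                     Σ (Fin (suc m)) λ t → (u ∈ bag t × v ∈ bag t)
    connected      : ∀ (v : Fin n) (t t' : Fin (suc m)) → v ∈ bag t → v ∈ bag t' →
                     TreeWalk parent (λ x → v ∈ bag x) t t'
open TreeDecomposition public

TreewidthAtMost : ∀ {n} → Graph n → ℕ → Set
TreewidthAtMost G k =
  Σ (TreeDecomposition G) λ T → ∀ t → ∣ bag T t ∣ ≤ suc k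

Assignment : ℕ → Set
Assignment n = Fin n → Bool

SatisfiesΦ : ∀ {n} → Graph n → Assignment n → Set
SatisfiesΦ {n} G A = ∀ (u v : Fin n) → adj G u v ≡ true → (A u ≡ true ⊎ A v ≡ true)

-- a literal: variable together with polarity (true = x, false = ¬x)
Literal : ℕ → Set
Literal n = Fin n × Bool

LitTrue : ∀ {n} → Assignment n → Literal n → Set
LitTrue A (x , b) = A x ≡ b

record Edge (n s : ℕ) : Set where
  constructor edge
  field
    src   : Fin s
    tgt   : Fin s
    label : Maybe (Literal n)
open Edge public

-- a directed multigraph on nodes Fin size (multiple edges = repeated list
-- entries), with designated root and leaf
record BP (n : ℕ) : Set where
  field
    size  : ℕ
    edges : List (Edge n size)
    root  : Fin size
    leaf  : Fin size
open BP public

data Path {n} (B : BP n) : Fin (size B) → Fin (size B) → Set where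
  nil  : ∀ {a} → Path B a a
  cons : ∀ {a c} (e : Edge n (size B)) → e LM.∈ edges B → src e ≡ a →
         Path B (tgt e) c → Path B a c

pathLength : ∀ {n} {B : BP n} {a b} → Path B a b → ℕ
pathLength nil = zero
pathLength (cons _ _ _ p) = suc (pathLength p)

pathLits : ∀ {n} {B : BP n} {a b} → Path B a b → List (Literal n)
pathLits nil = []
pathLits (cons e _ _ p) with label e
... | just l  = l ∷ pathLits p
... | nothing = pathLits p

record IsNROBP {n} (B : BP n) : Set where
  field
    acyclic        : ∀ a (p : Path B a a) → pathLength p ≡ 0
    root-no-in     : ∀ e → e LM.∈ edges B → tgt e ≢ root B
    nonroot-has-in : ∀ v → v ≢ root B → Σ (Edge n (size B)) λ e → (e LM.∈ edges B × tgt e ≡ v)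
    leaf-no-out    : ∀ e → e LM.∈ edges B → src e ≢ leaf B
    nonleaf-has-out : ∀ v → v ≢ leaf B → Σ (Edge n (size B)) λ e → (e LM.∈ edges B × src e ≡ v)
    read-once      : ∀ a b (p : Path B a b) → Unique (map proj₁ (pathLits p))

RealizesΦ : ∀ {n} → BP n → Graph n → Set
RealizesΦ {n} B G =
  IsNROBP B ×
  (∀ (p : Path B (root B) (leaf B)) (A : Assignment n) →
     All (LitTrue A) (pathLits p) → SatisfiesΦ G A) ×
  (∀ (A : Assignment n) → SatisfiesΦ G A →
     Σ (Path B (root B) (leaf B)) λ p → All (LitTrue A) (pathLits p))

{-# OPTIONS --safe #-}

-- The graphs are products of a complete ternary tree of depth r with a path on
-- K ≈ k / 2 vertices; joining the copy of the path at a node with the copy at its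
-- parent gives bags of size 2K. However the vertices are ordered, some prefix is
-- joined to its complement by a matching of size Ω(r K): of the three subtrees
-- below the root take the one whose good prefix comes second; at that moment the
-- subtree that was first has many vertices inside the prefix and the one that
-- will be last has many outside, so K further crossing edges exist outside the
-- middle subtree, and each level of the tree contributes K edges.
--
-- Given a branching program, order the variables along an accepting path by the
-- first node at which some path from the root has read them. For a node u and an
-- edge {a , b} such that a, but not b, can have been read before u, either all
-- assignments accepted through u set a or all of them set b. Hence every
-- accepting path meets a node that forces Ω(r K) variables to be true. The degree
-- being bounded, a random independent set misses a given set of that size with
-- probability 2^-Ω(r K), so with fewer than 2^Ω(r K) nodes some vertex cover would
-- be accepted through no node at all.
module Submission where

open import Defs hiding (sym)
open import Data.Bool using (Bool; true; false; not)
import Data.Bool.Properties as Bool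
open import Data.Empty using (⊥; ⊥-elim)
open import Data.Fin using (Fin; zero; suc; toℕ; fromℕ; inject₁; pred; combine; remQuot)
import Data.Fin.Properties as Fin
open import Data.Fin.Relation.Unary.Top using (view; ‵fromℕ; ‵inject₁; view-fromℕ; view-inject₁)
open import Data.Fin.Subset using (Subset; ⁅_⁆; _∪_; ∣_∣; inside; outside) renaming (⊥ to ∅; _∈_ to _∈ˢ_)
open import Data.Fin.Subset.Properties using (x∈⁅x⁆; x∈⁅y⁆⇒x≡y; x∈p∪q⁺; x∈p∪q⁻; ∉⊥; ∣⊥∣≡0; ∣⁅x⁆∣≡1)
open import Data.List as List using (List; []; _∷_; _++_; length; map; concatMap; filter; foldr; tabulate)
open import Data.List.Properties using (length-map; length-++; length-tabulate; map-++; filter-all; filter-accept; filter-reject)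
open import Data.List.Membership.Propositional using (_∈_; _∉_)
open import Data.List.Membership.Propositional.Properties using (∈-map⁺; ∈-map⁻; ∈-++⁺ˡ; ∈-++⁺ʳ; ∈-++⁻; ∈-concatMap⁺; ∈-tabulate⁺; ∈-tabulate⁻; ∈-lookup)
import Data.List.Membership.DecPropositional as DecMembership
open import Data.List.Relation.Unary.All as All using (All; []; _∷_)
import Data.List.Relation.Unary.All.Properties as All
open import Data.List.Relation.Unary.AllPairs as AllPairs using (AllPairs; []; _∷_)
import Data.List.Relation.Unary.AllPairs.Properties as AllPairs
open import Data.List.Relation.Unary.Any as Any using (Any; here; there)
open import Data.List.Relation.Unary.Unique.Propositional using (Unique)
open import Data.Maybe using (Maybe; just; nothing)
open import Data.Nat hiding (pred)
open import Data.Nat.Properties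
open import Data.Nat.Tactic.RingSolver using (solve-∀)
open import Data.Product using (Σ; _×_; _,_; proj₁; proj₂; ∃)
open import Data.Product.Properties using (≡-dec)
open import Data.Sum using (_⊎_; inj₁; inj₂; [_,_]′; swap)
open import Data.Unit using (tt)
open import Data.Vec as Vec using (Vec; []; _∷_; _[_]≔_; replicate)
open import Data.Vec.Properties using (lookup∘update; lookup∘update′; lookup-replicate; lookup-map)
open import Function using (_∘_; id; case_of_; mk⇔)
open import Function.Definitions using (Injective)
open import Relation.Binary.Definitions using (tri<; tri≈; tri>)
open import Relation.Binary.PropositionalEquality
open import Relation.Nullary using (¬_; Dec; yes; no; ¬?; contradiction; does)
open import Relation.Nullary.Decidable using (_⊎-dec_; _×-dec_; map′; decidable-stable; dec-true; dec-false; does-⇔; ¬¬-excluded-middle)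
open import Relation.Unary using (Decidable)

-- Filtered lists

module _ {X Y : Set} (f : X → Y) {P : Y → Set} (P? : Decidable P)
         (one : ∀ {y y′} → ¬ P y → ¬ P y′ → y ≡ y′) where

  -- Entries have distinct values under `f` and only one value can fail `P`, so nothing is dropped
  -- after the first dropped entry.
  length-filter-but-one : ∀ {xs} → AllPairs (λ x x′ → f x ≢ f x′) xs →
                          length xs ≤ suc (length (filter (P? ∘ f) xs))
  length-filter-but-one [] = z≤n
  length-filter-but-one {x ∷ xs} (x∉ ∷ u) with P? (f x)
  ... | yes _ = s≤s (length-filter-but-one u)
  ... | no ¬p = s≤s (≤-reflexive (cong length (sym (filter-all (P? ∘ f) (All.map keep x∉)))))
    where
    keep : ∀ {x′} → f x ≢ f x′ → P (f x′)
    keep {x′} ne with P? (f x′)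
    ... | yes p = p
    ... | no ¬p′ = contradiction (one ¬p ¬p′) ne

length-filter-∁ : ∀ {X : Set} {P : X → Set} (P? : Decidable P) xs →
                  length xs ≡ length (filter P? xs) + length (filter (¬? ∘ P?) xs)
length-filter-∁ P? [] = refl
length-filter-∁ P? (x ∷ xs) with P? x
... | yes _ = cong suc (length-filter-∁ P? xs)
... | no _  = trans (cong suc (length-filter-∁ P? xs)) (sym (+-suc _ _))

-- Derandomization by conditional expectations

PartialAssignment : ℕ → Set
PartialAssignment n = Vec (Maybe Bool) n

factor : Maybe Bool → Bool → ℕ
factor nothing      _     = 1
factor (just true)  true  = 2
factor (just true)  false = 0
factor (just false) true  = 0
factor (just false) false = 2

factor≤2 : ∀ m b → factor m b ≤ 2
factor≤2 nothing      _     = s≤s z≤n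
factor≤2 (just true)  true  = ≤-refl
factor≤2 (just true)  false = z≤n
factor≤2 (just false) true  = z≤n
factor≤2 (just false) false = ≤-refl

factor-same : ∀ b → factor (just b) b ≡ 2
factor-same true  = refl
factor-same false = refl

factor≢0 : ∀ c b → factor (just c) b ≢ 0 → c ≡ b
factor≢0 true  true  _ = refl
factor≢0 true  false p = contradiction refl p
factor≢0 false true  p = contradiction refl p
factor≢0 false false _ = refl

-- 2 ^ length C times the probability that a random completion of ρ makes all
-- literals of C true, provided that C has no repeated literals.
weight : ∀ {n} → PartialAssignment n → List (Literal n) → ℕ
weight ρ []            = 1
weight ρ ((y , b) ∷ C) = factor (Vec.lookup ρ y) b * weight ρ C

weight≤2^length : ∀ {n} (ρ : PartialAssignment n) C → weight ρ C ≤ 2 ^ length C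
weight≤2^length ρ []            = ≤-refl
weight≤2^length ρ ((y , b) ∷ C) = *-mono-≤ (factor≤2 (Vec.lookup ρ y) b) (weight≤2^length ρ C)

weight-nothing : ∀ {n} (C : List (Literal n)) → weight (replicate n nothing) C ≡ 1
weight-nothing []            = refl
weight-nothing ((y , b) ∷ C)
  rewrite lookup-replicate y (nothing {A = Bool}) | weight-nothing C = refl

weight≢0⇒true : ∀ {n} (r : Vec Bool n) C → weight (Vec.map just r) C ≢ 0 →
                All (LitTrue (Vec.lookup r)) C
weight≢0⇒true r []            _  = []
weight≢0⇒true r ((y , b) ∷ C) w≢0 rewrite lookup-map y just r =
  factor≢0 (Vec.lookup r y) b (λ f≡0 → w≢0 (cong (_* weight (Vec.map just r) C) f≡0)) ∷
  weight≢0⇒true r C (λ w≡0 → w≢0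
    (trans (cong (factor (just (Vec.lookup r y)) b *_) w≡0) (*-zeroʳ (factor (just (Vec.lookup r y)) b))))

Untouched : ∀ {n} → Fin n → List (Literal n) → Set
Untouched x = All (λ l → proj₁ l ≢ x)

weight-untouched : ∀ {n} (ρ : PartialAssignment n) {x} c {C} → Untouched x C →
                   weight (ρ [ x ]≔ c) C ≡ weight ρ C
weight-untouched ρ c []                    = refl
weight-untouched ρ c {(y , b) ∷ C} (y≢x ∷ u) =
  cong₂ (λ m w → factor m b * w) (lookup∘update′ y≢x ρ c) (weight-untouched ρ c u)

weight-set : ∀ {n} (ρ : PartialAssignment n) {x} b {C} → Vec.lookup ρ x ≡ nothing →
             (x , not b) ∉ C → weight ρ C ≤ weight (ρ [ x ]≔ just b) C
weight-set ρ b {[]} _ _ = ≤-refl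
weight-set ρ {x} b {(y , c) ∷ C} free ∉C = *-mono-≤ head (weight-set ρ b free (∉C ∘ there))
  where
  head : factor (Vec.lookup ρ y) c ≤ factor (Vec.lookup (ρ [ x ]≔ just b) y) c
  head with y Fin.≟ x
  ... | no y≢x rewrite lookup∘update′ y≢x ρ (just b) = ≤-refl
  ... | yes refl rewrite free | lookup∘update y ρ (just b) with c Bool.≟ b
  ...   | yes refl rewrite factor-same b = s≤s z≤n
  ...   | no c≢b = contradiction (here (cong (x ,_) (sym (Bool.¬-not c≢b)))) ∉C

weight-set-double : ∀ {n} (ρ : PartialAssignment n) {x} b {C} → Vec.lookup ρ x ≡ nothing →
                    (x , not b) ∉ C → (x , b) ∈ C →
                    weight ρ C + weight ρ C ≤ weight (ρ [ x ]≔ just b) C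
weight-set-double ρ {x} b {_ ∷ C} free ∉C (here refl)
  rewrite free | lookup∘update x ρ (just b) | factor-same b | +-identityʳ (weight ρ C)
        | +-identityʳ (weight (ρ [ x ]≔ just b) C)
  = +-mono-≤ ih ih
  where ih = weight-set ρ b free (∉C ∘ there)
weight-set-double ρ {x} b {(y , c) ∷ C} free ∉C (there i) = begin
  f * weight ρ C + f * weight ρ C                   ≡⟨ *-distribˡ-+ f _ _ ⟨
  f * (weight ρ C + weight ρ C)                     ≤⟨ *-mono-≤ head (weight-set-double ρ b free (∉C ∘ there) i) ⟩
  factor (Vec.lookup ρ′ y) c * weight ρ′ C ∎
  where
  open ≤-Reasoning
  ρ′ = ρ [ x ]≔ just b
  f = factor (Vec.lookup ρ y) c
  head : f ≤ factor (Vec.lookup ρ′ y) c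
  head = subst₂ _≤_ (*-identityʳ f) (*-identityʳ _)
           (weight-set ρ b {(y , c) ∷ []} free λ { (here p) → ∉C (here p) })

Consistent : ∀ {n} → List (Literal n) → Set
Consistent C = ∀ {x} → (x , true) ∈ C → (x , false) ∉ C

untouched : ∀ {n} {x : Fin n} C → (∀ b → (x , b) ∉ C) → Untouched x C
untouched C ∉C = All.tabulate λ { {y , b} i refl → ∉C b i }

module _ {n : ℕ} where
  open DecMembership (≡-dec (Fin._≟_ {n}) Bool._≟_) public using () renaming (_∈?_ to _∈ˡ?_)

touched? : ∀ {n} (x : Fin n) C → (∃ λ b → (x , b) ∈ C) ⊎ Untouched x C
touched? x C with (x , true) ∈ˡ? C
... | yes i = inj₁ (true , i)
... | no ∉t with (x , false) ∈ˡ? C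
...   | yes i = inj₁ (false , i)
...   | no ∉f = inj₂ (untouched C λ { true → ∉t ; false → ∉f })

-- By consistency at most one value of `x` falsifies `C`. A repeated literal counts with its
-- multiplicity, so fixing its variable may raise the average; this is the harmless direction for an
-- upper bound on misses.
weight-average : ∀ {n} (ρ : PartialAssignment n) x {C} → Consistent C → Vec.lookup ρ x ≡ nothing →
                 weight ρ C + weight ρ C ≤
                 weight (ρ [ x ]≔ just false) C + weight (ρ [ x ]≔ just true) C
weight-average ρ x {C} con free with touched? x C
... | inj₁ (true  , i) = m≤n⇒m≤o+n _ (weight-set-double ρ true free (con i) i)
... | inj₁ (false , i) = m≤n⇒m≤n+o _ (weight-set-double ρ false free (λ j → con j i) i)
... | inj₂ u = ≤-reflexive (sym (cong₂ _+_ (weight-untouched ρ _ u) (weight-untouched ρ _ u)))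

-- The variables are fixed one by one. If `false` increases `Φ`, the averaging hypothesis prevents
-- `true` from doing so.
derandomize : ∀ n (Φ : PartialAssignment n → ℕ) →
  (∀ ρ x → Vec.lookup ρ x ≡ nothing →
     Φ (ρ [ x ]≔ just false) + Φ (ρ [ x ]≔ just true) ≤ Φ ρ + Φ ρ) →
  Σ (Vec Bool n) λ r → Φ (Vec.map just r) ≤ Φ (replicate n nothing)
derandomize zero    Φ avg = [] , ≤-refl
derandomize (suc n) Φ avg with Φ (just false ∷ replicate n nothing) ≤? Φ (replicate (suc n) nothing)
... | yes p = let r , q = derandomize n (λ ρ → Φ (just false ∷ ρ)) (λ ρ x → avg (just false ∷ ρ) (suc x))
              in false ∷ r , ≤-trans q p
... | no ¬p = let r , q = derandomize n (λ ρ → Φ (just true ∷ ρ)) (λ ρ x → avg (just true ∷ ρ) (suc x))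
              in true ∷ r , ≤-trans q (≮⇒≥ λ lt → <⇒≱ (+-mono-< (≰⇒> ¬p) lt) (avg (replicate (suc n) nothing) zero refl))

VarDisjoint : ∀ {n} → List (Literal n) → List (Literal n) → Set
VarDisjoint C C′ = ∀ {x b} → (x , b) ∈ C → Untouched x C′

-- Estimates the probability that no clause of a list is made true entirely.
module _ (L : ℕ) where

  -- For a clause of length `L` this is `2 ^ L` times an estimate of the probability that some
  -- literal fails. The product in `missAll` treats clauses as independent, which disjoint variables
  -- justify; the sum in `totalMiss` is the union bound.
  miss : ∀ {n} → PartialAssignment n → List (Literal n) → ℕ
  miss ρ C = 2 ^ L ∸ weight ρ C

  missAll : ∀ {n} → PartialAssignment n → List (List (Literal n)) → ℕ
  missAll ρ []       = 1
  missAll ρ (C ∷ Cs) = miss ρ C * missAll ρ Cs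

  totalMiss : ∀ {n} → PartialAssignment n → List (List (List (Literal n))) → ℕ
  totalMiss ρ []       = 0
  totalMiss ρ (F ∷ Fs) = missAll ρ F + totalMiss ρ Fs

  Clause : ∀ {n} → List (Literal n) → Set
  Clause C = length C ≡ L × Consistent C

  miss-average : ∀ {n} (ρ : PartialAssignment n) x {C} → Clause C → Vec.lookup ρ x ≡ nothing →
                 miss (ρ [ x ]≔ just false) C + miss (ρ [ x ]≔ just true) C ≤ miss ρ C + miss ρ C
  miss-average ρ x {C} (refl , con) free = begin
    (N ∸ a) + (N ∸ b)   ≡⟨ ∸-+-∸ a≤ b≤ ⟩
    (N + N) ∸ (a + b)   ≤⟨ ∸-monoʳ-≤ (N + N) (weight-average ρ x con free) ⟩
    (N + N) ∸ (c + c)   ≡⟨ ∸-+-∸ c≤ c≤ ⟨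
    (N ∸ c) + (N ∸ c)   ∎
    where
    open ≤-Reasoning
    N = 2 ^ L
    a = weight (ρ [ x ]≔ just false) C
    b = weight (ρ [ x ]≔ just true) C
    c = weight ρ C
    a≤ = weight≤2^length (ρ [ x ]≔ just false) C
    b≤ = weight≤2^length (ρ [ x ]≔ just true) C
    c≤ = weight≤2^length ρ C
    ∸-+-∸ : ∀ {m n o p} → n ≤ m → p ≤ o → (m ∸ n) + (o ∸ p) ≡ (m + o) ∸ (n + p)
    ∸-+-∸ {m} {n} {o} {p} n≤m p≤o = begin-equality
      (m ∸ n) + (o ∸ p)   ≡⟨ +-∸-assoc (m ∸ n) p≤o ⟨
      ((m ∸ n) + o) ∸ p   ≡⟨ cong (_∸ p) (+-∸-comm o n≤m) ⟨
      ((m + o) ∸ n) ∸ p   ≡⟨ ∸-+-assoc (m + o) n p ⟩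
      (m + o) ∸ (n + p)   ∎

  missAll-untouched : ∀ {n} (ρ : PartialAssignment n) {x} c {Cs} → All (Untouched x) Cs →
                      missAll (ρ [ x ]≔ c) Cs ≡ missAll ρ Cs
  missAll-untouched ρ c []       = refl
  missAll-untouched ρ c (u ∷ us) =
    cong₂ (λ w m → (2 ^ L ∸ w) * m) (weight-untouched ρ c u) (missAll-untouched ρ c us)

  -- At most one of the factors depends on x.
  missAll-average : ∀ {n} (ρ : PartialAssignment n) x {Cs} → All Clause Cs → AllPairs VarDisjoint Cs →
                    Vec.lookup ρ x ≡ nothing →
                    missAll (ρ [ x ]≔ just false) Cs + missAll (ρ [ x ]≔ just true) Cs ≤
                    missAll ρ Cs + missAll ρ Cs
  missAll-average ρ x [] [] free = ≤-refl
  missAll-average ρ x {C ∷ Cs} (cl ∷ cls) (d ∷ ds) free with touched? x C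
  ... | inj₁ (b , i) = begin
    miss ρf C * missAll ρf Cs + miss ρt C * missAll ρt Cs
      ≡⟨ cong₂ (λ p q → miss ρf C * p + miss ρt C * q) (missAll-untouched ρ _ us) (missAll-untouched ρ _ us) ⟩
    miss ρf C * missAll ρ Cs + miss ρt C * missAll ρ Cs
      ≡⟨ *-distribʳ-+ (missAll ρ Cs) (miss ρf C) (miss ρt C) ⟨
    (miss ρf C + miss ρt C) * missAll ρ Cs
      ≤⟨ *-monoˡ-≤ (missAll ρ Cs) (miss-average ρ x cl free) ⟩
    (miss ρ C + miss ρ C) * missAll ρ Cs
      ≡⟨ *-distribʳ-+ (missAll ρ Cs) (miss ρ C) (miss ρ C) ⟩
    miss ρ C * missAll ρ Cs + miss ρ C * missAll ρ Cs ∎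
    where
    open ≤-Reasoning
    ρf = ρ [ x ]≔ just false
    ρt = ρ [ x ]≔ just true
    us : All (Untouched x) Cs
    us = All.map (λ dis → dis i) d
  ... | inj₂ u = begin
    miss ρf C * missAll ρf Cs + miss ρt C * missAll ρt Cs
      ≡⟨ cong₂ (λ p q → (2 ^ L ∸ p) * missAll ρf Cs + (2 ^ L ∸ q) * missAll ρt Cs) (weight-untouched ρ _ u) (weight-untouched ρ _ u) ⟩
    miss ρ C * missAll ρf Cs + miss ρ C * missAll ρt Cs
      ≡⟨ *-distribˡ-+ (miss ρ C) (missAll ρf Cs) (missAll ρt Cs) ⟨
    miss ρ C * (missAll ρf Cs + missAll ρt Cs)
      ≤⟨ *-monoʳ-≤ (miss ρ C) (missAll-average ρ x cls ds free) ⟩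
    miss ρ C * (missAll ρ Cs + missAll ρ Cs)
      ≡⟨ *-distribˡ-+ (miss ρ C) (missAll ρ Cs) (missAll ρ Cs) ⟩
    miss ρ C * missAll ρ Cs + miss ρ C * missAll ρ Cs ∎
    where
    open ≤-Reasoning
    ρf = ρ [ x ]≔ just false
    ρt = ρ [ x ]≔ just true

  ClauseSet : ∀ {n} → ℕ → List (List (Literal n)) → Set
  ClauseSet t F = length F ≡ t × All Clause F × AllPairs VarDisjoint F

  totalMiss-average : ∀ {n t} (ρ : PartialAssignment n) x {Fs} → All (ClauseSet t) Fs →
                      Vec.lookup ρ x ≡ nothing →
                      totalMiss (ρ [ x ]≔ just false) Fs + totalMiss (ρ [ x ]≔ just true) Fs ≤
                      totalMiss ρ Fs + totalMiss ρ Fs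
  totalMiss-average ρ x [] free = ≤-refl
  totalMiss-average ρ x {F ∷ Fs} ((_ , cl , dis) ∷ gs) free = begin
    (f + fs) + (t + ts)   ≡⟨ interchange f fs t ts ⟩
    (f + t) + (fs + ts)   ≤⟨ +-mono-≤ (missAll-average ρ x cl dis free) (totalMiss-average ρ x gs free) ⟩
    (e + e) + (es + es)   ≡⟨ interchange e e es es ⟩
    (e + es) + (e + es)   ∎
    where
    open ≤-Reasoning
    f  = missAll (ρ [ x ]≔ just false) F
    fs = totalMiss (ρ [ x ]≔ just false) Fs
    t  = missAll (ρ [ x ]≔ just true) F
    ts = totalMiss (ρ [ x ]≔ just true) Fs
    e  = missAll ρ F
    es = totalMiss ρ Fs
    interchange : ∀ a b c d → (a + b) + (c + d) ≡ (a + c) + (b + d)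
    interchange = solve-∀

  totalMiss-nothing : ∀ {n t} {Fs : List (List (List (Literal n)))} → All (ClauseSet t) Fs →
                      totalMiss (replicate n nothing) Fs ≡ length Fs * (2 ^ L ∸ 1) ^ t
  totalMiss-nothing [] = refl
  totalMiss-nothing {n} {Fs = F ∷ Fs} ((refl , _) ∷ gs) = cong₂ _+_ (missAll-nothing F) (totalMiss-nothing gs)
    where
    missAll-nothing : ∀ F → missAll (replicate n nothing) F ≡ (2 ^ L ∸ 1) ^ length F
    missAll-nothing []      = refl
    missAll-nothing (C ∷ F) = cong₂ (λ w m → (2 ^ L ∸ w) * m) (weight-nothing C) (missAll-nothing F)

  -- If every clause had weight 0, every factor of the product would be `2 ^ L`. Under a total
  -- assignment, a nonzero weight means that all literals are true.
  some-clause-true : ∀ {n} (r : Vec Bool n) F → missAll (Vec.map just r) F < (2 ^ L) ^ length F →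
                     Any (All (LitTrue (Vec.lookup r))) F
  some-clause-true r []      (s≤s ())
  some-clause-true r (C ∷ F) lt with weight (Vec.map just r) C in eq
  ... | suc w = here (weight≢0⇒true r C λ eq′ → contradiction (trans (sym eq) eq′) λ ())
  ... | zero  = there (some-clause-true r F (*-cancelˡ-< (2 ^ L) _ _ lt))

  -- Derandomization keeps the total below `(2 ^ L) ^ t`, whereas a single clause set missed
  -- entirely would already contribute that much.
  satisfy-one-clause-each : ∀ {n t} {Fs : List (List (List (Literal n)))} → All (ClauseSet t) Fs →
    length Fs * (2 ^ L ∸ 1) ^ t < (2 ^ L) ^ t →
    Σ (Vec Bool n) λ r → All (Any (All (LitTrue (Vec.lookup r)))) Fs
  satisfy-one-clause-each {n} {t} {Fs} gs few with derandomize n (λ ρ → totalMiss ρ Fs) (λ ρ x → totalMiss-average ρ x gs)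
  ... | r , le = r , each gs (≤-<-trans le (subst (_< (2 ^ L) ^ t) (sym (totalMiss-nothing gs)) few))
    where
    each : ∀ {Fs} → All (ClauseSet t) Fs → totalMiss (Vec.map just r) Fs < (2 ^ L) ^ t →
           All (Any (All (LitTrue (Vec.lookup r)))) Fs
    each [] _ = []
    each {F ∷ Fs} ((refl , _) ∷ gs) lt =
      some-clause-true r F (≤-<-trans (m≤m+n _ _) lt) ∷ each gs (≤-<-trans (m≤n+m _ _) lt)

-- Independent sets that meet many large vertex sets

module _ {A : Set} (_≟_ : (x y : A) → Dec (x ≡ y)) where
  open DecMembership _≟_ using (_∈?_)

  length-remove : ∀ y {ws} → Unique ws → length ws ≤ suc (length (filter (λ w → ¬? (w ≟ y)) ws))
  length-remove y = length-filter-but-one id (λ w → ¬? (w ≟ y)) λ ¬≢ ¬≢′ →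
    trans (decidable-stable (_ ≟ y) ¬≢) (sym (decidable-stable (_ ≟ y) ¬≢′))

  remove-list : ∀ ys {ws} → Unique ws → Σ (List A) λ vs → Unique vs × All (_∉ ys) vs ×
                All (_∈ ws) vs × length ws ≤ length ys + length vs
  remove-list [] {ws} u = ws , u , All.tabulate (λ _ ()) , All.tabulate id , ≤-refl
  remove-list (y ∷ ys) {ws} u =
    let vs , u′ , ∉ys , ⊆ws , len = remove-list ys u
        keep = λ w → ¬? (w ≟ y)
    in filter keep vs , AllPairs.filter⁺ keep u′ ,
       All.zipWith (λ { (≢y , ∉ys) (here p) → ≢y p ; (≢y , ∉ys) (there i) → ∉ys i })
         (All.all-filter keep vs , All.filter⁺ keep ∉ys) ,
       All.filter⁺ keep ⊆ws ,
       ≤-trans len (≤-trans (+-monoʳ-≤ (length ys) (length-remove y u′)) (≤-reflexive (+-suc (length ys) _)))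

  -- Greedily pick an element and discard all others near it.
  scatter : ∀ (near : A → List A) D → (∀ w → length (near w) ≤ D) → ∀ t {ws} → Unique ws →
            t * suc D ≤ length ws →
            Σ (List A) λ vs → length vs ≡ t × All (_∈ ws) vs × AllPairs (λ v v′ → v′ ∉ near v) vs
  scatter near D small zero    u le = [] , refl , [] , []
  scatter near D small (suc t) {w ∷ ws} (_ ∷ u) (s≤s le) =
    let vs , u′ , far , ⊆ws , len = remove-list (near w) u
        vs′ , len′ , ⊆vs , sep = scatter near D small t u′
          (+-cancelˡ-≤ D _ _ (≤-trans le (≤-trans len (+-monoˡ-≤ (length vs) (small w)))))
    in w ∷ vs′ , cong suc len′ , here refl ∷ All.map (there ∘ All.lookup ⊆ws) ⊆vs ,
       All.map (All.lookup far) ⊆vs ∷ sep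

record Neighbourhoods {n} (G : Graph n) (d : ℕ) : Set where
  field
    candidates : Fin n → List (Fin n)
    length-candidates : ∀ v → length (candidates v) ≡ d
    neighbour∈candidates : ∀ {u v} → adj G u v ≡ true → v ∈ candidates u

module _ {n} (G : Graph n) {d} (nbh : Neighbourhoods G d) where
  open Neighbourhoods nbh

  -- Non-neighbours among the candidates are replaced by a repetition of the
  -- positive literal of w, so that all clauses have the same length.
  isolate : Fin n → Fin n → Literal n
  isolate w y with adj G w y
  ... | true  = y , false
  ... | false = w , true

  -- The event that `w` is chosen and none of its neighbours is. The vertices whose event occurs
  -- form an independent set.
  isolation : Fin n → List (Literal n)
  isolation w = (w , true) ∷ map (isolate w) (candidates w)

  ∈-isolation-true : ∀ {w x} → (x , true) ∈ isolation w → x ≡ w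
  ∈-isolation-true (here refl) = refl
  ∈-isolation-true {w} (there i) with ∈-map⁻ (isolate w) i
  ... | y , _ , eq with adj G w y
  ∈-isolation-true {w} (there i) | y , _ , refl | false = refl

  ∈-isolation-false : ∀ {w x} → (x , false) ∈ isolation w → adj G w x ≡ true
  ∈-isolation-false (here ())
  ∈-isolation-false {w} (there i) with ∈-map⁻ (isolate w) i
  ... | y , _ , eq with adj G w y in wy
  ∈-isolation-false {w} (there i) | y , _ , refl | true = wy

  neighbour∈isolation : ∀ {w x} → adj G w x ≡ true → (x , false) ∈ isolation w
  neighbour∈isolation {w} {x} wx =
    there (subst (_∈ map (isolate w) (candidates w)) isolate≡ (∈-map⁺ (isolate w) (neighbour∈candidates wx)))
    where
    isolate≡ : isolate w x ≡ (x , false)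
    isolate≡ rewrite wx = refl

  isolation-clause : ∀ w → Clause (suc d) (isolation w)
  isolation-clause w = cong suc (trans (length-map (isolate w) (candidates w)) (length-candidates w)) ,
    λ i j → adjacent-self (∈-isolation-true i) (∈-isolation-false j)
    where
    adjacent-self : ∀ {x} → x ≡ w → adj G w x ≢ true
    adjacent-self refl ww with () ← trans (sym ww) (irrefl G w)

  closed : Fin n → List (Fin n)
  closed w = w ∷ candidates w

  near : Fin n → List (Fin n)
  near w = concatMap closed (closed w)

  length-near : ∀ w → length (near w) ≡ suc d * suc d
  length-near w = trans (go (closed w)) (cong (λ m → suc m * suc d) (length-candidates w))
    where
    go : ∀ ys → length (concatMap closed ys) ≡ length ys * suc d
    go []       = refl
    go (y ∷ ys) = trans (length-++ (closed y)) (cong₂ (λ a b → suc a + b) (length-candidates y) (go ys))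

  var∈closed : ∀ {w x b} → (x , b) ∈ isolation w → x ∈ closed w
  var∈closed {b = true}  i = here (∈-isolation-true i)
  var∈closed {b = false} i = there (neighbour∈candidates (∈-isolation-false i))

  var∈closed′ : ∀ {w x b} → (x , b) ∈ isolation w → w ∈ closed x
  var∈closed′ {b = true}  i = here (sym (∈-isolation-true i))
  var∈closed′ {w} {x} {false} i = there (neighbour∈candidates (trans (Graph.sym G x w) (∈-isolation-false i)))

  -- A common variable would be `w` or a neighbour of it, and `w′` would be that variable or a
  -- neighbour of it; `near` contains everything within two such steps.
  far⇒disjoint : ∀ {w w′} → w′ ∉ near w → VarDisjoint (isolation w) (isolation w′)
  far⇒disjoint {w} {w′} far {x} i = untouched (isolation w′) λ b j →
    far (∈-concatMap⁺ closed (Any.map (λ { refl → var∈closed′ j }) (var∈closed i)))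

  separation : ℕ
  separation = suc (suc d * suc d)

  isolate-one : ∀ t {ws} → Unique ws → t * separation ≤ length ws →
    Σ (List (List (Literal n))) λ F → ClauseSet (suc d) t F × All (λ C → ∃ λ w → w ∈ ws × C ≡ isolation w) F
  isolate-one t u le =
    let vs , len , ⊆ws , sep = scatter Fin._≟_ near (suc d * suc d) (λ w → ≤-reflexive (length-near w)) t u le
    in map isolation vs ,
       (trans (length-map isolation vs) len , All.map⁺ (All.tabulate λ {v} _ → isolation-clause v) ,
        AllPairs.map⁺ (AllPairs.map far⇒disjoint sep)) ,
       All.map⁺ (All.map (λ {v} i → v , i , refl) ⊆ws)

  all-true? : ∀ (r : Vec Bool n) (C : List (Literal n)) → Dec (All (LitTrue (Vec.lookup r)) C)
  all-true? r = All.all? (λ { (x , b) → Vec.lookup r x Bool.≟ b })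

  -- The complement of the independent set of isolated vertices, hence a vertex cover.
  cover : Vec Bool n → Assignment n
  cover r v with all-true? r (isolation v)
  ... | yes _ = false
  ... | no  _ = true

  cover-false : ∀ r {v} → All (LitTrue (Vec.lookup r)) (isolation v) → cover r v ≡ false
  cover-false r {v} p with all-true? r (isolation v)
  ... | yes _ = refl
  ... | no ¬p = contradiction p ¬p

  cover-satisfies : ∀ r → SatisfiesΦ G (cover r)
  cover-satisfies r u v uv with all-true? r (isolation u) | all-true? r (isolation v)
  ... | no _  | _     = inj₁ refl
  ... | yes _ | no _  = inj₂ refl
  ... | yes p | yes (q ∷ _) with () ← trans (sym q) (All.lookup p (neighbour∈isolation uv))

  -- Each set contains `t` vertices whose isolation clauses share no variables. Making one of these
  -- clauses true in every set isolates a vertex there, and the cover omits it.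
  hitting-assignment : ∀ t {Ws : List (List (Fin n))} →
    All (λ ws → Unique ws × t * separation ≤ length ws) Ws →
    length Ws * (2 ^ suc d ∸ 1) ^ t < (2 ^ suc d) ^ t →
    Σ (Assignment n) λ A → SatisfiesΦ G A × All (Any (λ w → A w ≡ false)) Ws
  hitting-assignment t {Ws} gs few =
    let Fs , sets , len , from = collect gs
        r , hit = satisfy-one-clause-each (suc d) sets (subst (λ m → m * _ < _) (sym len) few)
    in cover r , cover-satisfies r , from r hit
    where
    Hits : Vec Bool n → List (List (List (Literal n))) → List (List (Fin n)) → Set
    Hits r Fs Ws = All (Any (All (LitTrue (Vec.lookup r)))) Fs → All (Any (λ w → cover r w ≡ false)) Ws

    hit-one : ∀ r {F ws} → All (λ C → ∃ λ w → w ∈ ws × C ≡ isolation w) F →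
              Any (All (LitTrue (Vec.lookup r))) F → Any (λ w → cover r w ≡ false) ws
    hit-one r ((w , i , refl) ∷ _) (here p) = Any.map (λ { refl → cover-false r p }) i
    hit-one r (_ ∷ as) (there j) = hit-one r as j

    collect : ∀ {Ws} → All (λ ws → Unique ws × t * separation ≤ length ws) Ws →
              Σ (List (List (List (Literal n)))) λ Fs → All (ClauseSet (suc d) t) Fs ×
              length Fs ≡ length Ws × (∀ r → Hits r Fs Ws)
    collect [] = [] , [] , refl , λ r _ → []
    collect ((u , le) ∷ gs) =
      let F , set , from = isolate-one t u le
          Fs , sets , len , hits = collect gs
      in F ∷ Fs , set ∷ sets , cong suc len , λ { r (h ∷ hs) → hit-one r from h ∷ hits r hs }

-- Branching programs

unique-++ : ∀ {X : Set} {x : X} xs {ys} → Unique (xs ++ ys) → x ∈ xs → x ∉ ys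
unique-++ (_ ∷ xs) (x∉ ∷ _) (here refl) j = All.lookup x∉ (∈-++⁺ʳ xs j) refl
unique-++ (_ ∷ xs) (_ ∷ u)  (there i)   j = unique-++ xs u i j

-- Double-negation shift over a finite type. It lets finitely many statements count as decided while
-- a contradiction is being derived.
¬¬-∀ : ∀ n {P : Fin n → Set} → (∀ i → ¬ ¬ P i) → ¬ ¬ (∀ i → P i)
¬¬-∀ zero    h k = k λ ()
¬¬-∀ (suc n) h k = h zero λ p → ¬¬-∀ n (h ∘ suc) λ ps → k λ { zero → p ; (suc i) → ps i }

-- One witness is kept per index. The bound `s` makes the later union bound run over the nodes of
-- the program and not over all the sets that they force.
collect : ∀ s {X : Set} {P : Fin s → X → Set} → (∀ u → Dec (∃ (P u))) →
  Σ (List X) λ L → length L ≤ s × All (λ x → ∃ λ u → P u x) L × (∀ u → ∃ (P u) → Any (P u) L)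
collect zero    dec = [] , z≤n , [] , λ ()
collect (suc s) dec with dec zero | collect s (dec ∘ suc)
... | yes (x , p) | L , len , ok , find =
  x ∷ L , s≤s len , (zero , p) ∷ All.map (λ { (u , q) → suc u , q }) ok ,
  λ { zero _ → here p ; (suc u) e → there (find u e) }
... | no ¬p | L , len , ok , find =
  L , m≤n⇒m≤1+n len , All.map (λ { (u , q) → suc u , q }) ok ,
  λ { zero e → contradiction e ¬p ; (suc u) e → find u e }

-- Only ends on the same side are compared; ends on opposite sides of a cut differ anyway.
EdgeDisjoint : ∀ {V : Set} → V × V → V × V → Set
EdgeDisjoint (a , b) (a′ , b′) = a ≢ a′ × b ≢ b′

record CutMatching {V : Set} (Adj : V → V → Set) (ρ : V → ℕ) (T : ℕ) : Set where
  field
    threshold : ℕ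
    matching  : List (V × V)
    size-matching : T ≤ length matching
    disjoint  : AllPairs EdgeDisjoint matching
    crossing  : All (λ { (a , b) → Adj a b × ρ a < threshold × threshold ≤ ρ b }) matching

-- `ρ` ranges over linear orders of the vertices and the threshold selects a prefix, so this is the
-- lower bound `T` on matching width as a parameter of linear layouts.
MatchingWidth : ∀ {V : Set} → (V → V → Set) → ℕ → Set
MatchingWidth {V} Adj T = ∀ (ρ : V → ℕ) → Injective _≡_ _≡_ ρ → CutMatching Adj ρ T

module _ {n : ℕ} where
  open DecMembership (Fin._≟_ {n}) public using (_∈?_)

  restrict : List (Fin n) → Assignment n → Assignment n → Assignment n
  restrict xs A A′ x with x ∈? xs
  ... | yes _ = A x
  ... | no  _ = A′ x

  restrict-∈ : ∀ {xs A A′ x} → x ∈ xs → restrict xs A A′ x ≡ A x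
  restrict-∈ {xs} {x = x} i with x ∈? xs
  ... | yes _ = refl
  ... | no ∉ = contradiction i ∉

  restrict-∉ : ∀ {xs A A′ x} → x ∉ xs → restrict xs A A′ x ≡ A′ x
  restrict-∉ {xs} {x = x} ∉ with x ∈? xs
  ... | yes i = contradiction i ∉
  ... | no _ = refl

module _ {n : ℕ} (B : BP n) where

  _▷_ : ∀ {a b c} → Path B a b → Path B b c → Path B a c
  nil           ▷ q = q
  cons e i eq p ▷ q = cons e i eq (p ▷ q)

  pathLits-▷ : ∀ {a b c} (p : Path B a b) (q : Path B b c) →
               pathLits (p ▷ q) ≡ pathLits p ++ pathLits q
  pathLits-▷ nil q = refl
  pathLits-▷ (cons e i eq p) q with label e
  ... | just l  = cong (l ∷_) (pathLits-▷ p q)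
  ... | nothing = pathLits-▷ p q

  vars : ∀ {a b} → Path B a b → List (Fin n)
  vars p = map proj₁ (pathLits p)

  vars-▷ : ∀ {a b c} (p : Path B a b) (q : Path B b c) → vars (p ▷ q) ≡ vars p ++ vars q
  vars-▷ p q = trans (cong (map proj₁) (pathLits-▷ p q)) (map-++ proj₁ (pathLits p) (pathLits q))

  single : (e : Edge n (size B)) → e ∈ edges B → Path B (src e) (tgt e)
  single e i = cons e i refl nil

  vars-single-one : ∀ e i {x y} → x ∈ vars (single e i) → y ∈ vars (single e i) → x ≡ y
  vars-single-one e i x∈ y∈ with label e
  vars-single-one e i (here refl) (here refl) | just l = refl

  Follows : ∀ {a b} → Assignment n → Path B a b → Set
  Follows A p = All (LitTrue A) (pathLits p)

  follows-▷ : ∀ {A a b c} (p : Path B a b) {q : Path B b c} → Follows A p → Follows A q → Follows A (p ▷ q)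
  follows-▷ {A} p {q} fp fq = subst (All (LitTrue A)) (sym (pathLits-▷ p q)) (All.++⁺ fp fq)

  follows-▷ˡ : ∀ {A a b c} (p : Path B a b) {q : Path B b c} → Follows A (p ▷ q) → Follows A p
  follows-▷ˡ {A} p {q} f = All.++⁻ˡ (pathLits p) (subst (All (LitTrue A)) (pathLits-▷ p q) f)

  follows-▷ʳ : ∀ {A a b c} (p : Path B a b) {q : Path B b c} → Follows A (p ▷ q) → Follows A q
  follows-▷ʳ {A} p {q} f = All.++⁻ʳ (pathLits p) (subst (All (LitTrue A)) (pathLits-▷ p q) f)

  follows-cong : ∀ {A A′ a b} (p : Path B a b) → (∀ {x} → x ∈ vars p → A x ≡ A′ x) →
                 Follows A′ p → Follows A p
  follows-cong p eq f = All.tabulate λ i → trans (eq (∈-map⁺ proj₁ i)) (All.lookup f i)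

  -- One path into `u` that reads `x` suffices. By read-once, no path out of `u` then reads `x`,
  -- whichever path led to `u`.
  Known : Fin (size B) → Fin n → Set
  Known u x = Σ (Path B (root B) u) λ p → x ∈ vars p

  known-▷ : ∀ {u w x} → Path B u w → Known u x → Known w x
  known-▷ q (p , i) = p ▷ q , subst (_ ∈_) (sym (vars-▷ p q)) (∈-++⁺ˡ i)

  Through : Fin (size B) → Assignment n → Set
  Through u A = Σ (Path B (root B) u) λ p → Σ (Path B u (leaf B)) λ q → Follows A p × Follows A q

  Forces : Fin (size B) → Fin n → Set
  Forces u x = ∀ A → Through u A → A x ≡ true

  module _ {G : Graph n} (real : RealizesΦ B G) where

    private
      sound = proj₁ (proj₂ real)
      complete = proj₂ (proj₂ real)

    known-unread : ∀ {u w x} → Known u x → (q : Path B u w) → x ∉ vars q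
    known-unread (p , i) q =
      unique-++ (vars p) (subst Unique (vars-▷ p q) (IsNROBP.read-once (proj₁ real) _ _ (p ▷ q))) i

    -- Variables that an accepting path does not read may all be switched to false, which would
    -- violate the clause.
    unread-edge : ∀ {A a b} (p : Path B (root B) (leaf B)) → Follows A p → adj G a b ≡ true →
                  a ∉ vars p → b ∉ vars p → ⊥
    unread-edge {A} {a} {b} p f ab a∉ b∉
      with sound p (restrict (vars p) A (λ _ → false)) (follows-cong p restrict-∈ f) a b ab
    ... | inj₁ t with () ← trans (sym t) (restrict-∉ a∉)
    ... | inj₂ t with () ← trans (sym t) (restrict-∉ b∉)

    -- If a path into u avoided setting a and a path out of u avoided setting b,
    -- their concatenation would accept an assignment violating a ∨ b.
    forces-one : ∀ {u a b} → Known u a → ¬ Known u b → adj G a b ≡ true → ¬ ¬ (Forces u a ⊎ Forces u b)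
    forces-one {u} {a} {b} ka ¬kb ab k = ¬¬-excluded-middle {A = ∃ λ A → Through u A × A a ≡ false} λ
      { (no none) → k (inj₁ λ A th → Bool.¬-not (λ t → none (A , th , t)))
      ; (yes (A₁ , (p , _ , fp , _) , a₁)) → k (inj₂ λ A₂ (_ , q , _ , fq) → Bool.¬-not (λ b₂ → splice A₁ A₂ p q fp fq a₁ b₂))
      }
      where
      splice : ∀ A₁ A₂ (p : Path B (root B) u) (q : Path B u (leaf B)) → Follows A₁ p → Follows A₂ q →
                A₁ a ≡ false → A₂ b ≡ false → ⊥
      splice A₁ A₂ p q fp fq a₁ b₂
        with sound (p ▷ q) A₃ (follows-▷ p (follows-cong p restrict-∈ fp) (follows-cong q on-q fq)) a b ab
        where
        -- Variables read by neither path default to false, so `a` and `b` are false wherever they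
        -- go unread. By read-once, `q` reads neither `a` nor any variable of `p`.
        A₃ = restrict (vars p) A₁ (restrict (vars q) A₂ (λ _ → false))
        on-q : ∀ {x} → x ∈ vars q → A₃ x ≡ A₂ x
        on-q i = trans (restrict-∉ (λ j → known-unread (p , j) q i)) (restrict-∈ i)
      ... | inj₁ t with a ∈? vars p
      ...   | yes i with () ← trans (sym t) a₁
      ...   | no _ with () ← trans (sym t) (restrict-∉ (known-unread ka q))
      splice A₁ A₂ p q fp fq a₁ b₂ | inj₂ t with b ∈? vars p
      ...   | yes i = ¬kb (p , i)
      ...   | no _ with b ∈? vars q
      ...     | yes _ with () ← trans (sym t) b₂
      splice A₁ A₂ p q fp fq a₁ b₂ | inj₂ () | no _ | no _

    Split : Fin (size B) → Fin n × Fin n → Set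
    Split u (a , b) = Known u a × ¬ Known u b × adj G a b ≡ true

    -- Every split edge contributes a forced end. Contributions differ: on the same side by
    -- disjointness, on opposite sides because one is known at `u` and the other is not.
    forced-set : ∀ {u M} → AllPairs EdgeDisjoint M → All (Split u) M →
      ¬ ¬ (Σ (List (Fin n)) λ W → Unique W × length W ≡ length M × All (Forces u) W ×
           All (λ w → Any (λ { (a , b) → w ≡ a ⊎ w ≡ b }) M) W)
    forced-set [] [] k = k ([] , [] , refl , [] , [])
    forced-set {u} {(a , b) ∷ M} (d ∷ ds) ((ka , ¬kb , ab) ∷ ss) k =
      forced-set ds ss λ { (W , uW , len , fW , from) →
      forces-one ka ¬kb ab λ
      { (inj₁ fa) → k (a ∷ W , All.map (new-a d ss) from ∷ uW , cong suc len , fa ∷ fW ,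
                       here (inj₁ refl) ∷ All.map there from)
      ; (inj₂ fb) → k (b ∷ W , All.map (new-b d ss) from ∷ uW , cong suc len , fb ∷ fW ,
                       here (inj₂ refl) ∷ All.map there from) } }
      where
      new-a : ∀ {M w} → All (EdgeDisjoint (a , b)) M → All (Split u) M →
              Any (λ { (a , b) → w ≡ a ⊎ w ≡ b }) M → a ≢ w
      new-a ((a≢ , _) ∷ _) _ (here (inj₁ refl)) = a≢
      new-a _ ((_ , ¬k , _) ∷ _) (here (inj₂ refl)) refl = ¬k ka
      new-a (_ ∷ ds) (_ ∷ ss) (there i) = new-a ds ss i
      new-b : ∀ {M w} → All (EdgeDisjoint (a , b)) M → All (Split u) M →
              Any (λ { (a , b) → w ≡ a ⊎ w ≡ b }) M → b ≢ w
      new-b ((_ , b≢) ∷ _) _ (here (inj₂ refl)) = b≢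
      new-b _ ((k , _) ∷ _) (here (inj₁ refl)) refl = ¬kb k
      new-b (_ ∷ ds) (_ ∷ ss) (there i) = new-b ds ss i

    -- The order of the variables along an accepting path

    module _ (known? : ∀ (u : Fin (size B)) x → Dec (Known u x)) where

      unknown : Fin (size B) → Fin n → ℕ
      unknown u x with known? u x
      ... | yes _ = 0
      ... | no _  = 1

      unknown-known : ∀ {u x} → Known u x → unknown u x ≡ 0
      unknown-known {u} {x} k with known? u x
      ... | yes _ = refl
      ... | no ¬k = contradiction k ¬k

      unknown-unknown : ∀ {u x} → ¬ Known u x → unknown u x ≡ 1
      unknown-unknown {u} {x} ¬k with known? u x
      ... | yes k = contradiction k ¬k
      ... | no _ = refl

      unknown≤1 : ∀ u x → unknown u x ≤ 1
      unknown≤1 u x with known? u x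
      ... | yes _ = z≤n
      ... | no _  = ≤-refl

      -- Knowledge only grows along a path, so this counts the nodes that precede the first one at
      -- which `x` is known.
      misses : ∀ {u w} → Path B u w → Fin n → ℕ
      misses {u} nil            x = unknown u x
      misses {u} (cons _ _ _ q) x = unknown u x + misses q x

      OnPath : ∀ {u w} → Fin (size B) → Path B u w → Set
      OnPath {u} v nil            = v ≡ u
      OnPath {u} v (cons _ _ _ q) = v ≡ u ⊎ OnPath v q

      prefix : ∀ {u v w} (q : Path B u w) → OnPath v q → Path B u v
      prefix nil             refl        = nil
      prefix (cons _ _ _ _)  (inj₁ refl) = nil
      prefix (cons e i eq q) (inj₂ o)    = cons e i eq (prefix q o)

      misses-known : ∀ {u w x} (q : Path B u w) → Known u x → misses q x ≡ 0
      misses-known nil k = unknown-known k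
      misses-known (cons e i refl q) k =
        cong₂ _+_ (unknown-known k) (misses-known q (known-▷ (single e i) k))

      misses-unknown : ∀ {u w x} (q : Path B u w) → ¬ Known u x → 0 < misses q x
      misses-unknown nil ¬k = ≤-reflexive (sym (unknown-unknown ¬k))
      misses-unknown (cons _ _ _ q) ¬k = m≤n⇒m≤n+o _ (≤-reflexive (sym (unknown-unknown ¬k)))

      misses-< : ∀ {u v w x y} (q : Path B u w) → OnPath v q → Known v x → ¬ Known v y →
                 misses q x < misses q y
      misses-< {y = y} q@nil refl kx ¬ky = subst (_< misses q y) (sym (misses-known q kx)) (misses-unknown q ¬ky)
      misses-< {y = y} q@(cons _ _ _ _) (inj₁ refl) kx ¬ky =
        subst (_< misses q y) (sym (misses-known q kx)) (misses-unknown q ¬ky)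
      misses-< {u} {x = x} {y} q@(cons _ _ _ q′) (inj₂ o) kx ¬ky =
        -- `y` is unknown at the later node `v`, hence already at `u`, so the current node counts
        -- for `y`; the strict gain comes from the rest of the path.
        +-mono-≤-< (subst (unknown u x ≤_) (sym (unknown-unknown (λ k → ¬ky (known-▷ (prefix q (inj₂ o)) k)))) (unknown≤1 u x))
                   (misses-< q′ o kx ¬ky)

      -- Orders the variables by the first node of the path at which they are
      -- known; ties are broken by the index.
      rank : ∀ {u w} → Path B u w → Fin n → ℕ
      rank p x = misses p x * n + toℕ x

      rank-< : ∀ {u w} (p : Path B u w) {x y} → misses p x < misses p y → rank p x < rank p y
      rank-< p {x} {y} lt = begin-strict
        misses p x * n + toℕ x   <⟨ +-monoʳ-< (misses p x * n) (Fin.toℕ<n x) ⟩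
        misses p x * n + n       ≡⟨ +-comm (misses p x * n) n ⟩
        suc (misses p x) * n     ≤⟨ *-monoˡ-≤ n lt ⟩
        misses p y * n           ≤⟨ m≤m+n _ _ ⟩
        misses p y * n + toℕ y   ∎
        where open ≤-Reasoning

      rank-injective : ∀ {u w} (p : Path B u w) → Injective _≡_ _≡_ (rank p)
      rank-injective p {x} {y} eq with <-cmp (misses p x) (misses p y)
      ... | tri< lt _ _ = contradiction eq (<⇒≢ (rank-< p lt))
      ... | tri> _ _ gt = contradiction (sym eq) (<⇒≢ (rank-< p gt))
      ... | tri≈ _ e _  = Fin.toℕ-injective (+-cancelˡ-≡ (misses p x * n) _ _
                            (trans eq (cong (λ m → m * n + toℕ y) (sym e))))

      module _ (ρ : Fin n → ℕ) (τ : ℕ) (M : List (Fin n × Fin n)) (dis : AllPairs EdgeDisjoint M)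
               (cross : All (λ { (a , b) → adj G a b ≡ true × ρ a < τ × τ ≤ ρ b }) M)
               {t : ℕ} (long : 2 + (t + t) ≤ length M) where

        Cut : Fin (size B) → Set
        Cut u = Σ (List (Fin n × Fin n)) λ N → t ≤ length N × AllPairs EdgeDisjoint N × All (Split u) N

        -- Each matching edge that is not touched by the label of the edge from u
        -- to v is split by what is known at u or by what is known at v.
        cut-at-edge : ∀ {A} e (i : e ∈ edges B) (p : Path B (root B) (src e)) (q : Path B (tgt e) (leaf B)) →
          Follows A (p ▷ (single e i ▷ q)) →
          (∀ {x} → Known (src e) x → ρ x < τ) → (∀ {x} → ρ x < τ → Known (tgt e) x) →
          Cut (src e) ⊎ Cut (tgt e)
        cut-at-edge e i p q f below above = halves
          where
          lab = vars (single e i)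
          Off : Fin n → Set
          Off x = x ∉ lab
          off? : Decidable Off
          off? x = ¬? (x ∈? lab)
          one : ∀ {x y} → ¬ Off x → ¬ Off y → x ≡ y
          one {x} {y} ¬ox ¬oy with x ∈? lab | y ∈? lab
          ... | yes i∈ | yes j∈ = vars-single-one e i i∈ j∈
          ... | no ox | _ = contradiction ox ¬ox
          ... | _ | no oy = contradiction oy ¬oy

          -- The label reads at most one variable, so at most one matching edge is lost on each
          -- side. This accounts for the 2 in `long`.
          M₁ = filter (off? ∘ proj₁) M
          M₂ = filter (off? ∘ proj₂) M₁
          known-src = λ (ab : Fin n × Fin n) → known? (src e) (proj₁ ab)
          Mu = filter known-src M₂
          Mv = filter (¬? ∘ known-src) M₂

          dis₂ : AllPairs EdgeDisjoint M₂
          dis₂ = AllPairs.filter⁺ (off? ∘ proj₂) (AllPairs.filter⁺ (off? ∘ proj₁) dis)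

          length-M₂ : t + t ≤ length Mu + length Mv
          length-M₂ = begin
            t + t                  ≤⟨ ∸-monoˡ-≤ 2 long ⟩
            length M ∸ 2           ≤⟨ ∸-monoˡ-≤ 2 (length-filter-but-one proj₁ off? one (AllPairs.map proj₁ dis)) ⟩
            length M₁ ∸ 1          ≤⟨ ∸-monoˡ-≤ 1 (length-filter-but-one proj₂ off? one
                                        (AllPairs.map proj₂ (AllPairs.filter⁺ (off? ∘ proj₁) dis))) ⟩
            length M₂              ≡⟨ length-filter-∁ known-src M₂ ⟩
            length Mu + length Mv  ∎
            where open ≤-Reasoning

          Info : Fin n × Fin n → Set
          Info (a , b) = (adj G a b ≡ true × ρ a < τ × τ ≤ ρ b) × Off a × Off b

          info : All Info M₂
          info = All.zipWith (λ { ((c , oa) , ob) → c , oa , ob })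
            (All.filter⁺ (off? ∘ proj₂) (All.zip (All.filter⁺ (off? ∘ proj₁) cross , All.all-filter (off? ∘ proj₁) M)) ,
             All.all-filter (off? ∘ proj₂) M₁)

          split-src : ∀ {ab} → Info ab × Known (src e) (proj₁ ab) → Split (src e) ab
          split-src (((ab , _ , τ≤) , _) , ka) = ka , (λ kb → <⇒≱ (below kb) τ≤) , ab

          unread : ∀ {x} → ¬ Known (src e) x → Off x → Known (tgt e) x → x ∉ vars (p ▷ (single e i ▷ q))
          unread ¬k off k x∈ with ∈-++⁻ (vars p) (subst (_ ∈_) (vars-▷ p (single e i ▷ q)) x∈)
          ... | inj₁ x∈p = ¬k (p , x∈p)
          ... | inj₂ x∈q with ∈-++⁻ lab (subst (_ ∈_) (vars-▷ (single e i) q) x∈q)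
          ...   | inj₁ x∈e = off x∈e
          ...   | inj₂ x∈q = known-unread k q x∈q

          -- If `b` were known at the target, neither `a` nor `b` would be read before the edge, on
          -- it or after it, against `unread-edge`.
          split-tgt : ∀ {ab} → Info ab × ¬ Known (src e) (proj₁ ab) → Split (tgt e) ab
          split-tgt (((ab , a< , τ≤) , oa , ob) , ¬ka) = above a< ,
            (λ kb → unread-edge (p ▷ (single e i ▷ q)) f ab (unread ¬ka oa (above a<))
                      (unread (λ k → <⇒≱ (below k) τ≤) ob kb)) , ab

          halves : Cut (src e) ⊎ Cut (tgt e)
          halves with t ≤? length Mu | t ≤? length Mv
          ... | yes le | _ = inj₁ (Mu , le , AllPairs.filter⁺ known-src dis₂ ,
                  All.map split-src (All.zip (All.filter⁺ known-src info , All.all-filter known-src M₂)))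
          ... | no _ | yes le = inj₂ (Mv , le , AllPairs.filter⁺ (¬? ∘ known-src) dis₂ ,
                  All.map split-tgt (All.zip (All.filter⁺ (¬? ∘ known-src) info , All.all-filter (¬? ∘ known-src) M₂)))
          ... | no ¬l | no ¬l′ = contradiction length-M₂ (<⇒≱ (+-mono-< (≰⇒> ¬l) (≰⇒> ¬l′)))

        -- The path is followed up to the first edge after which a variable of rank at least `τ` is
        -- known. If there is no such edge, the leaf itself splits the whole matching, since an
        -- accepting path reads an end of every edge.
        find-cut : ∀ {A u} (p : Path B (root B) u) (q : Path B u (leaf B)) → Follows A p → Follows A q →
          (∀ {x} → Known u x → ρ x < τ) →
          (∀ {v x y} → OnPath v q → Known v x → ¬ Known v y → ρ x < ρ y) →
          ∃ λ v → Through v A × Cut v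
        find-cut {A} p nil fp fq below chain =
          leaf B , (p , nil , fp , fq) , M , ≤-trans (≤-trans (m≤m+n t t) (m≤n+m (t + t) 2)) long , dis , All.map split cross
          where
          split : ∀ {ab} → adj G (proj₁ ab) (proj₂ ab) ≡ true × ρ (proj₁ ab) < τ × τ ≤ ρ (proj₂ ab) → Split (leaf B) ab
          split {a , b} (ab , _ , τ≤) with known? (leaf B) a
          ... | yes ka = ka , ¬kb , ab
            where ¬kb = λ k → <⇒≱ (below k) τ≤
          ... | no ¬ka = ⊥-elim (unread-edge p fp ab (λ i → ¬ka (p , i)) (λ i → <⇒≱ (below (p , i)) τ≤))
        find-cut {A} p (cons e i refl q) fp fq below chain
          with Fin.all? (λ x → known-below? x)
          where
          known-below? : ∀ x → Dec (Known (tgt e) x → ρ x < τ)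
          known-below? x with ρ x <? τ | known? (tgt e) x
          ... | yes lt | _      = yes λ _ → lt
          ... | no _   | no ¬k  = yes λ k → contradiction k ¬k
          ... | no ¬lt | yes k  = no λ h → ¬lt (h k)
        ... | yes below′ = find-cut (p ▷ single e i) q (follows-▷ p fp (follows-▷ˡ (single e i) fq)) (follows-▷ʳ (single e i) fq)
                             (λ {x} → below′ x) (chain ∘ inj₂)
        ... | no ¬below with cut-at-edge e i p q (follows-▷ p fp fq) below above
          where
          first : ∀ {u w} (q : Path B u w) → OnPath u q
          first nil = refl
          first (cons _ _ _ _) = inj₁ refl
          -- Some variable of rank at least `τ` is known at the target, and by `chain` every
          -- variable unknown there has a larger rank.
          above : ∀ {x} → ρ x < τ → Known (tgt e) x
          above {y} y<τ with known? (tgt e) y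
          ... | yes k = k
          ... | no ¬k = ⊥-elim (¬below λ x kx → <-trans (chain (inj₂ (first q)) kx ¬k) y<τ)
        ...   | inj₁ cut = src e , (p , cons e i refl q , fp , fq) , cut
        ...   | inj₂ cut = tgt e , (p ▷ single e i , q ,
                   follows-▷ p fp (follows-▷ˡ (single e i) fq) , follows-▷ʳ (single e i) fq) , cut

    known-root : ∀ {x} → ¬ Known (root B) x
    known-root (nil , ())
    known-root (p@(cons _ _ _ _) , _) with () ← IsNROBP.acyclic (proj₁ real) _ p

    -- With too few nodes, one vertex cover would omit a vertex from a large forced set of every
    -- node that has one. But an accepting path for this cover visits such a node, which forces that
    -- vertex to be true.
    matching-width⇒large : ∀ {d} (nbh : Neighbourhoods G d) t →
      MatchingWidth (λ a b → adj G a b ≡ true) (2 + (t * separation G nbh + t * separation G nbh)) →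
      (2 ^ suc d) ^ t ≤ size B * (2 ^ suc d ∸ 1) ^ t
    matching-width⇒large {d} nbh t width = ≮⇒≥ λ few →
      -- The goal is now `⊥`, so `Known` and the existence of large forced sets may be treated as
      -- decidable.
      ¬¬-∀ (size B) (λ u → ¬¬-∀ n λ x → ¬¬-excluded-middle {A = Known u x}) λ known? →
      ¬¬-∀ (size B) (λ u → ¬¬-excluded-middle {A = ∃ (Good u)}) λ good? →
      main few known? good?
      where
      t₁ = t * separation G nbh

      Good : Fin (size B) → List (Fin n) → Set
      Good u W = (Unique W × t₁ ≤ length W) × All (Forces u) W

      clash-at-cut : ∀ {A Ws} (known? : ∀ u x → Dec (Known u x)) (P : Path B (root B) (leaf B)) → Follows A P →
        All (Any (λ w → A w ≡ false)) Ws → (∀ u → ∃ (Good u) → Any (Good u) Ws) →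
        CutMatching (λ a b → adj G a b ≡ true) (rank known? P) (2 + (t₁ + t₁)) → ⊥
      clash-at-cut {A} {Ws} known? P follows hit find cm =
        at-node (find-cut known? (rank known? P) threshold matching disjoint crossing
          {t = t₁} size-matching nil P [] follows
          (λ k → ⊥-elim (known-root k))
          (λ o kx ¬ky → rank-< known? P (misses-< known? P o kx ¬ky)))
        where
        open CutMatching cm
        clash : ∀ {v Ws} → Through v A → All (Any (λ w → A w ≡ false)) Ws → Any (Good v) Ws → ⊥
        clash th (h ∷ _) (here (_ , f)) = one-clash h f
          where
          one-clash : ∀ {W} → Any (λ w → A w ≡ false) W → All (Forces _) W → ⊥
          one-clash (here eq) (f ∷ _) with () ← trans (sym eq) (f A th)
          one-clash (there i) (_ ∷ fs) = one-clash i fs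
        clash th (_ ∷ hs) (there j) = clash th hs j

        at-node : (∃ λ v → Through v A × Σ (List (Fin n × Fin n)) λ N →
                     t₁ ≤ length N × AllPairs EdgeDisjoint N × All (Split v) N) → ⊥
        at-node (v , through , N , long , dis , split) = forced-set dis split λ { (W , uW , lenW , fW , _) →
          clash through hit (find v (W , (uW , subst (t₁ ≤_) (sym lenW) long) , fW)) }

      main : size B * (2 ^ suc d ∸ 1) ^ t < (2 ^ suc d) ^ t →
             (∀ u x → Dec (Known u x)) → (∀ u → Dec (∃ (Good u))) → ⊥
      main few known? good? with collect (size B) good?
      ... | Ws , len , good , find
        with hitting-assignment G nbh t (All.map (λ { (u , g , _) → g }) good)
               (≤-<-trans (*-monoˡ-≤ ((2 ^ suc d ∸ 1) ^ t) len) few)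
      ... | A , sat , hit with complete A sat
      ... | P , follows = clash-at-cut known? P follows hit find (width (rank known? P) (rank-injective known? P))

-- Thresholds that split a list of distinct values

enumerate : ∀ {X : Set} {K} (xs : List X) → Unique xs → length xs ≡ K →
            Σ (Fin K → X) λ f → Injective _≡_ _≡_ f × (∀ q → f q ∈ xs)
enumerate xs u refl = List.lookup xs , lookup-injective u , ∈-lookup
  where
  lookup-injective : ∀ {xs} → Unique xs → Injective _≡_ _≡_ (List.lookup xs)
  lookup-injective (_ ∷ _)  {zero}  {zero}  _  = refl
  lookup-injective (x∉ ∷ _) {zero}  {suc j} eq = contradiction eq (All.lookup x∉ (∈-lookup j))
  lookup-injective (x∉ ∷ _) {suc i} {zero}  eq = contradiction (sym eq) (All.lookup x∉ (∈-lookup i))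
  lookup-injective (_ ∷ u)  {suc i} {suc j} eq = cong suc (lookup-injective u eq)

discrete-ivt : ∀ (g : ℕ → ℕ) → g 0 ≡ 0 → (∀ τ → g (suc τ) ≤ suc (g τ)) → ∀ N {a} → a ≤ g N → ∃ λ τ → g τ ≡ a
discrete-ivt g g0 slow zero {a} a≤ = 0 , trans g0 (sym (n≤0⇒n≡0 (subst (a ≤_) g0 a≤)))
discrete-ivt g g0 slow (suc N) {a} a≤ with a ≤? g N
... | yes le = discrete-ivt g g0 slow N le
... | no ¬le = suc N , ≤-antisym (≤-trans (slow N) (≰⇒> ¬le)) a≤

module _ {X : Set} (f : X → ℕ) where

  below : ℕ → List X → List X
  below τ = filter (λ x → f x <? τ)

  below-< : ∀ {τ x xs} → f x < τ → below τ (x ∷ xs) ≡ x ∷ below τ xs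
  below-< {τ} = filter-accept (λ x → f x <? τ)

  below-≮ : ∀ {τ x xs} → ¬ f x < τ → below τ (x ∷ xs) ≡ below τ xs
  below-≮ {τ} = filter-reject (λ x → f x <? τ)

  length-below-≢ : ∀ {τ xs} → All (λ x → f x ≢ τ) xs → length (below (suc τ) xs) ≡ length (below τ xs)
  length-below-≢ [] = refl
  length-below-≢ {τ} {x ∷ xs} (≢τ ∷ ≢s) with <-cmp (f x) τ
  ... | tri≈ _ eq _ = contradiction eq ≢τ
  ... | tri< lt _ _ rewrite below-< {xs = xs} lt | below-< {xs = xs} (m<n⇒m<1+n lt) = cong suc (length-below-≢ ≢s)
  ... | tri> ¬lt _ gt rewrite below-≮ {xs = xs} ¬lt | below-≮ {xs = xs} (≤⇒≯ gt) = length-below-≢ ≢s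

  length-below-suc : ∀ τ {xs} → AllPairs (λ x y → f x ≢ f y) xs → length (below (suc τ) xs) ≤ suc (length (below τ xs))
  length-below-suc τ [] = z≤n
  length-below-suc τ {x ∷ xs} (d ∷ ds) with <-cmp (f x) τ
  ... | tri≈ ¬lt eq _ rewrite below-≮ {xs = xs} ¬lt | below-< {xs = xs} (s≤s (≤-reflexive eq)) =
    s≤s (≤-reflexive (length-below-≢ (All.map (λ ne eq′ → ne (trans eq (sym eq′))) d)))
  ... | tri< lt _ _ rewrite below-< {xs = xs} lt | below-< {xs = xs} (m<n⇒m<1+n lt) = s≤s (length-below-suc τ ds)
  ... | tri> ¬lt _ gt rewrite below-≮ {xs = xs} ¬lt | below-≮ {xs = xs} (≤⇒≯ gt) = length-below-suc τ ds

  bounded : ∀ xs → ∃ λ N → All (λ x → f x < N) xs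
  bounded []       = 0 , []
  bounded (x ∷ xs) with N , ps ← bounded xs =
    suc (f x) ⊔ N , m≤m⊔n (suc (f x)) N ∷ All.map (λ lt → <-≤-trans lt (m≤n⊔m (suc (f x)) N)) ps

  -- Raising the threshold by one admits at most one more entry because the values are distinct, so
  -- the number of entries below it passes through `a`.
  split-at-threshold : ∀ a b {xs} → AllPairs (λ x y → f x ≢ f y) xs → length xs ≡ a + b →
    ∃ λ τ → length (below τ xs) ≡ a × length (filter (λ x → ¬? (f x <? τ)) xs) ≡ b
  split-at-threshold a b {xs} ds len =
    let N , all = bounded xs
        τ , eq = discrete-ivt (λ τ → length (below τ xs)) (below-0 xs) (λ τ → length-below-suc τ ds) N
                   (subst (a ≤_) (sym (trans (cong length (filter-all (λ x → f x <? N) all)) len)) (m≤m+n a b))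
    in τ , eq , +-cancelˡ-≡ a _ _ (trans (cong (_+ length (filter (λ x → ¬? (f x <? τ)) xs)) (sym eq))
         (trans (sym (length-filter-∁ (λ x → f x <? τ) xs)) len))
    where
    below-0 : ∀ xs → length (below 0 xs) ≡ 0
    below-0 [] = refl
    below-0 (x ∷ xs) = below-0 xs

-- The product of a complete ternary tree and a path

data Node : ℕ → Set where
  apex  : ∀ {r} → Node r
  child : ∀ {r} → Fin 3 → Node r → Node (suc r)

child-injective : ∀ {r i j} {x y : Node r} → child i x ≡ child j y → i ≡ j × x ≡ y
child-injective refl = refl , refl

-- The junk value up apex = apex does no harm, since Adjacent excludes loops;
-- the same holds for pred zero = zero.
up : ∀ {r} → Node r → Node r
up apex                  = apex
up (child i apex)        = apex
up (child i (child j x)) = child i (up (child j x))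

module _ {K : ℕ} where

  Vertex : ℕ → Set
  Vertex r = Node r × Fin K

  Step : ∀ {r} → Vertex r → Vertex r → Set
  Step (x , j) (y , j′) = (up x ≡ y × j ≡ j′) ⊎ (x ≡ y × pred j ≡ j′)

  Adjacent : ∀ {r} → Vertex r → Vertex r → Set
  Adjacent u v = u ≢ v × (Step u v ⊎ Step v u)

  lift : ∀ {r} → Fin 3 → Vertex r → Vertex (suc r)
  lift i (x , j) = child i x , j

  lift-injective : ∀ {r i} {u v : Vertex r} → lift i u ≡ lift i v → u ≡ v
  lift-injective refl = refl

  lift-adjacent : ∀ {r i} {u v : Vertex r} → Adjacent u v → Adjacent (lift i u) (lift i v)
  lift-adjacent {i = i} (u≢v , s) = u≢v ∘ lift-injective , [ inj₁ ∘ lift-step u≢v , inj₂ ∘ lift-step (u≢v ∘ sym) ]′ s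
    where
    lift-step : ∀ {r} {u v : Vertex r} → u ≢ v → Step u v → Step (lift i u) (lift i v)
    lift-step {u = apex , _}      u≢v (inj₁ (refl , refl)) = contradiction refl u≢v
    lift-step {u = child _ _ , _} u≢v (inj₁ (refl , refl)) = inj₁ (refl , refl)
    lift-step u≢v (inj₂ (refl , eq)) = inj₂ (refl , eq)

-- Crossing edges and the matching width of the product

record CrossingEdge {r K} (χ : Vertex {K} r → Bool) (P : Vertex {K} r → Set) : Set where
  constructor crossingEdge
  field
    inner outer : Vertex {K} r
    adjacent    : Adjacent inner outer
    inner-in    : χ inner ≡ true
    outer-out   : χ outer ≡ false
    inner-P     : P inner
    outer-P     : P outer

orient : ∀ {r K} {χ : Vertex {K} r → Bool} {P : Vertex {K} r → Set} {u v} →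
         Step u v → χ u ≢ χ v → P u → P v → CrossingEdge χ P
orient {χ = χ} {P} {u} {v} s ne pu pv with χ u in eu | χ v in ev
... | true  | true  = contradiction refl ne
... | false | false = contradiction refl ne
... | true  | false = crossingEdge u v (u≢v , inj₁ s) eu ev pu pv
  where u≢v = λ u≡v → contradiction (trans (sym eu) (trans (cong χ u≡v) ev)) λ ()
... | false | true  = crossingEdge v u (v≢u , inj₂ s) ev eu pv pu
  where v≢u = λ v≡u → contradiction (trans (sym ev) (trans (cong χ v≡u) eu)) λ ()

-- The colour changes at some edge on the way from `child i x` up to the apex, and the lower end of
-- that edge lies in subtree `i`.
tree-crossing : ∀ {r} (χ : Node (suc r) → Bool) i x → χ (child i x) ≢ χ apex →
                ∃ λ y → χ (child i y) ≢ χ (up (child i y))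
tree-crossing χ i x ne with χ (child i apex) Bool.≟ χ apex
... | no ne′ = apex , ne′
tree-crossing χ i apex ne | yes eq = contradiction eq ne
tree-crossing χ i (child j x) ne | yes eq
  with tree-crossing (χ ∘ child i) j x (λ e → ne (trans e eq))
... | y , ne′ = child j y , ne′

path-crossing : ∀ {κ} (χ : Fin (suc κ) → Bool) j → χ j ≢ χ zero → ∃ λ y → χ y ≢ χ (pred y)
path-crossing χ zero ne = contradiction refl ne
path-crossing {suc κ} χ (suc j) ne with χ (suc zero) Bool.≟ χ zero
... | no ne′ = suc zero , ne′
... | yes eq with path-crossing (χ ∘ suc) j (λ e → ne (trans e eq))
...   | zero  , ne′ = contradiction refl ne′
...   | suc y , ne′ = suc (suc y) , ne′

median : (f : Fin 3 → ℕ) → ∃ λ b → ∃ λ i → ∃ λ i′ → i ≢ b × i′ ≢ b × f i ≤ f b × f b ≤ f i′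
median f
  with ≤-total (f zero) (f (suc zero)) | ≤-total (f (suc zero)) (f (suc (suc zero)))
     | ≤-total (f zero) (f (suc (suc zero)))
... | inj₁ p | inj₁ q | _      = suc zero , zero , suc (suc zero) , (λ ()) , (λ ()) , p , q
... | inj₂ p | inj₂ q | _      = suc zero , suc (suc zero) , zero , (λ ()) , (λ ()) , q , p
... | inj₁ p | inj₂ q | inj₁ s = suc (suc zero) , zero , suc zero , (λ ()) , (λ ()) , s , q
... | inj₁ p | inj₂ q | inj₂ s = zero , suc (suc zero) , suc zero , (λ ()) , (λ ()) , s , p
... | inj₂ p | inj₁ q | inj₁ s = zero , suc zero , suc (suc zero) , (λ ()) , (λ ()) , p , s
... | inj₂ p | inj₁ q | inj₂ s = suc (suc zero) , suc zero , zero , (λ ()) , (λ ()) , q , s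

module _ {κ : ℕ} where

  private
    K = suc κ
    V = Vertex {K}

  Outside : ∀ {r} → Fin 3 → V (suc r) → Set
  Outside b v = ∀ y → proj₁ v ≢ child b y

  module _ {r} (χ : V (suc r) → Bool) {b i i′ : Fin 3} (i≢b : i ≢ b) (i′≢b : i′ ≢ b)
           (low high : Fin K → V r)
           (low-in : ∀ q → χ (lift i (low q)) ≡ true) (high-out : ∀ q → χ (lift i′ (high q)) ≡ false) where

    outside-up : ∀ {h j} → h ≢ b → ∀ (y : Node r) → Outside b (up (child h y) , j)
    outside-up h≢b apex        z ()
    outside-up h≢b (child _ _) z eq = h≢b (proj₁ (child-injective eq))

    row-crossing : ∀ {h} → h ≢ b → ∀ j {x} → χ (child h x , j) ≢ χ (apex , j) →
                   CrossingEdge χ (λ v → proj₂ v ≡ j × Outside b v)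
    row-crossing {h} h≢b j {x} ne with tree-crossing (λ y → χ (y , j)) h x ne
    ... | y , ne′ = orient (inj₁ (refl , refl)) ne′
                      (refl , λ z eq → h≢b (proj₁ (child-injective eq))) (refl , outside-up {j = j} h≢b y)

    column-crossing : ∀ {h} → h ≢ b → ∀ {x j j′} → χ (child h x , j) ≢ χ (child h x , j′) →
                      CrossingEdge χ (λ v → proj₁ v ≡ child h x × Outside b v)
    column-crossing {h} h≢b {x} {j} {j′} ne =
      let y , ne′ = differing in orient (inj₂ (refl , refl)) ne′ (refl , out) (refl , out)
      where
      out : ∀ z → child h x ≢ child b z
      out z eq = h≢b (proj₁ (child-injective eq))
      colour = λ j → χ (child h x , j)
      differing : ∃ λ y → colour y ≢ colour (pred y)
      differing with colour j Bool.≟ colour zero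
      ... | no ne₀  = path-crossing colour j ne₀
      ... | yes eq₀ = path-crossing colour j′ (λ eq → ne (trans eq₀ (sym eq)))

    -- Comparing with the apex is enough: a row that is not mixed has a single colour on all columns
    -- of `low` and `high`.
    Mixed : Fin K → Set
    Mixed j = ∃ λ q → χ (child i (proj₁ (low q)) , j) ≢ χ (apex , j) ⊎ χ (child i′ (proj₁ (high q)) , j) ≢ χ (apex , j)

    mixed? : ∀ j → Dec (Mixed j)
    mixed? j = Fin.any? λ q → ¬? (_ Bool.≟ _) ⊎-dec ¬? (_ Bool.≟ _)

    -- Either every row has a crossing tree edge, or some row is constant, and
    -- then the columns of low or those of high all have a crossing path edge.
    rows-or-columns :
      (∀ j → CrossingEdge χ (λ v → proj₂ v ≡ j × Outside b v)) ⊎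
      (∀ q → CrossingEdge χ (λ v → proj₁ v ≡ child i (proj₁ (low q)) × Outside b v)) ⊎
      (∀ q → CrossingEdge χ (λ v → proj₁ v ≡ child i′ (proj₁ (high q)) × Outside b v))
    rows-or-columns with Fin.all? mixed?
    ... | yes mixed = inj₁ λ j → case mixed j of λ
      { (q , inj₁ ne) → row-crossing i≢b j ne
      ; (q , inj₂ ne) → row-crossing i′≢b j ne }
    ... | no ¬mixed with Fin.¬∀⟶∃¬ K Mixed mixed? ¬mixed
    -- If the single colour of row `j` is `false`, each column of `low` has both colours because of
    -- its vertex `low q`; if it is `true`, the same holds for `high`.
    ...   | j , pure with χ (apex , j)
    ...     | false = inj₂ (inj₁ λ q → column-crossing i≢b {j = proj₂ (low q)} {j} λ e →
                contradiction (trans (sym (low-in q)) (trans e (low-row q))) λ ())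
      where
      low-row : ∀ q → χ (child i (proj₁ (low q)) , j) ≡ false
      low-row q = decidable-stable (_ Bool.≟ _) λ ne → pure (q , inj₁ ne)
    ...     | true = inj₂ (inj₂ λ q → column-crossing i′≢b {j = proj₂ (high q)} {j} λ e →
                contradiction (trans (sym (high-out q)) (trans e (high-row q))) λ ())
      where
      high-row : ∀ q → χ (child i′ (proj₁ (high q)) , j) ≡ true
      high-row q = decidable-stable (_ Bool.≟ _) λ ne → pure (q , inj₂ ne)

    Crossing : V (suc r) × V (suc r) → Set
    Crossing (a , c) = Adjacent a c × χ a ≡ true × χ c ≡ false

    record NewEdges : Set where
      field
        newEdge  : Fin K → V (suc r) × V (suc r)
        disjoint : ∀ {p q} → p ≢ q → EdgeDisjoint (newEdge p) (newEdge q)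
        crosses  : ∀ q → Crossing (newEdge q)
        avoids   : ∀ q → Outside b (proj₁ (newEdge q)) × Outside b (proj₂ (newEdge q))

    -- The tag is the row or the tree node. Both ends of an edge carry its tag, so edges with
    -- different tags share no end.
    new-edges-by-tag : ∀ {Tag : Set} (tag : V (suc r) → Tag) (g : Fin K → Tag) → Injective _≡_ _≡_ g →
                       (∀ q → CrossingEdge χ (λ v → tag v ≡ g q × Outside b v)) → NewEdges
    new-edges-by-tag tag g g-inj ce = record
      { newEdge  = λ q → inner (ce q) , outer (ce q)
      ; disjoint = λ {p} {q} p≢q →
          (λ eq → p≢q (g-inj (trans (sym (proj₁ (inner-P (ce p)))) (trans (cong tag eq) (proj₁ (inner-P (ce q))))))) ,
          (λ eq → p≢q (g-inj (trans (sym (proj₁ (outer-P (ce p)))) (trans (cong tag eq) (proj₁ (outer-P (ce q)))))))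
      ; crosses  = λ q → adjacent (ce q) , inner-in (ce q) , outer-out (ce q)
      ; avoids   = λ q → proj₂ (inner-P (ce q)) , proj₂ (outer-P (ce q))
      }
      where open CrossingEdge

    new-edges : Injective _≡_ _≡_ (proj₁ ∘ low) → Injective _≡_ _≡_ (proj₁ ∘ high) → NewEdges
    new-edges low-inj high-inj with rows-or-columns
    ... | inj₁ rows        = new-edges-by-tag proj₂ id id rows
    ... | inj₂ (inj₁ cols) = new-edges-by-tag proj₁ _ (low-inj ∘ proj₂ ∘ child-injective) cols
    ... | inj₂ (inj₂ cols) = new-edges-by-tag proj₁ _ (high-inj ∘ proj₂ ∘ child-injective) cols

  -- The induction hypothesis is strengthened: `K` columns have a vertex below the threshold and `K`
  -- columns have one that is not below. The next level needs them when some row is constant.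
  record Balanced {r} (ρ : V r → ℕ) (s : ℕ) : Set where
    field
      cut : CutMatching Adjacent ρ (s * K)
    open CutMatching cut public
    field
      low high : Fin K → V r
      low-inj  : Injective _≡_ _≡_ (proj₁ ∘ low)
      high-inj : Injective _≡_ _≡_ (proj₁ ∘ high)
      low<     : ∀ q → ρ (low q) < threshold
      high≥    : ∀ q → threshold ≤ ρ (high q)

  -- The two siblings that yield the new edges also supply `low` and `high` for the larger tree,
  -- since their thresholds bracket that of the middle subtree, which is kept.
  balanced-step : ∀ {r s} (ρ : V (suc r) → ℕ) → (∀ i → Balanced (ρ ∘ lift i) s) → Balanced ρ (suc s)
  balanced-step {r} {s} ρ bal with median (λ i → Balanced.threshold (bal i))
  ... | b , i , i′ , i≢b , i′≢b , τi≤τ , τ≤τi′ = record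
    { cut = record
      { threshold     = τ
      ; matching      = old ++ new
      ; size-matching = begin
          K + s * K                                   ≤⟨ +-monoʳ-≤ K (size-matching (bal b)) ⟩
          K + length (matching (bal b))               ≡⟨ +-comm K _ ⟩
          length (matching (bal b)) + K               ≡⟨ cong₂ _+_ (length-map lift² (matching (bal b))) (length-tabulate newEdge) ⟨
          length old + length new                     ≡⟨ length-++ old ⟨
          length (old ++ new)                         ∎
      ; disjoint      = AllPairs.++⁺
          (AllPairs.map⁺ (AllPairs.map (λ { (p , q) → p ∘ lift-injective , q ∘ lift-injective }) (disjoint (bal b))))
          (AllPairs.tabulate⁺ (NewEdges.disjoint ne))
          (All.map⁺ (All.tabulate λ {e} _ → All.tabulate⁺ λ q →
            lift≢outside (proj₁ e) (proj₁ (newEdge q)) (proj₁ (avoids q)) ,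
            lift≢outside (proj₂ e) (proj₂ (newEdge q)) (proj₂ (avoids q))))
      ; crossing      = All.++⁺
          (All.map⁺ (All.map (λ { (ad , lt , ge) → lift-adjacent ad , lt , ge }) (crossing (bal b))))
          (All.tabulate⁺ λ q → let ad , p , n = crosses q in ad , χ-true p , χ-false n)
      }
    ; low      = lift i ∘ low (bal i)
    ; high     = lift i′ ∘ high (bal i′)
    ; low-inj  = low-inj (bal i) ∘ proj₂ ∘ child-injective
    ; high-inj = high-inj (bal i′) ∘ proj₂ ∘ child-injective
    ; low<     = low<′
    ; high≥    = high≥′
    }
    where
    open Balanced
    open ≤-Reasoning
    τ = threshold (bal b)
    χ : V (suc r) → Bool
    χ v = does (ρ v <? τ)
    χ-true : ∀ {v} → χ v ≡ true → ρ v < τ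
    χ-true {v} eq = decidable-stable (ρ v <? τ) λ ¬lt →
      contradiction (trans (sym eq) (dec-false (ρ v <? τ) ¬lt)) λ ()
    χ-false : ∀ {v} → χ v ≡ false → τ ≤ ρ v
    χ-false {v} eq = ≮⇒≥ λ lt → contradiction (trans (sym eq) (dec-true (ρ v <? τ) lt)) λ ()
    low<′ : ∀ q → ρ (lift i (low (bal i) q)) < τ
    low<′ q = <-≤-trans (low< (bal i) q) τi≤τ
    high≥′ : ∀ q → τ ≤ ρ (lift i′ (high (bal i′) q))
    high≥′ q = ≤-trans τ≤τi′ (high≥ (bal i′) q)
    low-in : ∀ q → χ (lift i (low (bal i) q)) ≡ true
    low-in q = dec-true (_ <? τ) (low<′ q)
    high-out : ∀ q → χ (lift i′ (high (bal i′) q)) ≡ false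
    high-out q = dec-false (_ <? τ) (≤⇒≯ (high≥′ q))
    ne : NewEdges χ i≢b i′≢b (low (bal i)) (high (bal i′)) low-in high-out
    ne = new-edges χ i≢b i′≢b (low (bal i)) (high (bal i′)) low-in high-out (low-inj (bal i)) (high-inj (bal i′))
    open NewEdges ne using (newEdge; crosses; avoids)
    lift≢outside : ∀ u v → Outside b v → lift b u ≢ v
    lift≢outside u _ out refl = out (proj₁ u) refl
    lift² : V r × V r → V (suc r) × V (suc r)
    lift² (u , v) = lift b u , lift b v
    old = map lift² (matching (bal b))
    new = tabulate newEdge

  spine : ∀ {r} → Fin (suc r) → Node r
  spine         zero    = apex
  spine {suc r} (suc i) = child zero (spine i)

  spine-injective : ∀ {r} → Injective _≡_ _≡_ (spine {r})
  spine-injective {_}     {zero}  {zero}  _  = refl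
  spine-injective {suc r} {zero}  {suc j} ()
  spine-injective {suc r} {suc i} {zero}  ()
  spine-injective {suc r} {suc i} {suc j} eq = cong suc (spine-injective (proj₂ (child-injective eq)))

  -- A branch of the tree meets `K + K` different columns, and some threshold leaves `K` of its
  -- vertices in row `zero` on either side. This is what the bottom `K + K` levels are for.
  balanced-base : (ρ : V (K + K) → ℕ) → Injective _≡_ _≡_ ρ → Balanced ρ 0
  balanced-base ρ ρ-inj =
    let τ , len-lo , len-hi = split-at-threshold f K K distinct (length-tabulate (spine ∘ inject₁))
        lo , lo-inj , lo∈ = enumerate (filter (λ x → f x <? τ) xs) (AllPairs.filter⁺ (λ x → f x <? τ) unique) len-lo
        hi , hi-inj , hi∈ = enumerate (filter (λ x → ¬? (f x <? τ)) xs) (AllPairs.filter⁺ (λ x → ¬? (f x <? τ)) unique) len-hi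
    in record
      { cut      = record { threshold = τ ; matching = [] ; size-matching = z≤n ; disjoint = [] ; crossing = [] }
      ; low      = λ q → lo q , zero
      ; high     = λ q → hi q , zero
      ; low-inj  = lo-inj
      ; high-inj = hi-inj
      ; low<     = λ q → All.lookup (All.all-filter (λ x → f x <? τ) xs) (lo∈ q)
      ; high≥    = λ q → ≮⇒≥ (All.lookup (All.all-filter (λ x → ¬? (f x <? τ)) xs) (hi∈ q))
      }
    where
    f : Node (K + K) → ℕ
    f x = ρ (x , zero)
    xs = tabulate (spine ∘ inject₁)
    unique : Unique xs
    unique = AllPairs.tabulate⁺ λ p≢q eq → p≢q (Fin.inject₁-injective (spine-injective eq))
    distinct : AllPairs (λ x y → f x ≢ f y) xs
    distinct = AllPairs.map (λ x≢y eq → x≢y (cong proj₁ (ρ-inj eq))) unique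

  balanced : ∀ s (ρ : V (s + (K + K)) → ℕ) → Injective _≡_ _≡_ ρ → Balanced ρ s
  balanced zero    ρ ρ-inj = balanced-base ρ ρ-inj
  balanced (suc s) ρ ρ-inj = balanced-step ρ λ i → balanced s (ρ ∘ lift i) (lift-injective ∘ ρ-inj)

  matching-width : ∀ s → MatchingWidth (Adjacent {K} {s + (K + K)}) (s * K)
  matching-width s ρ ρ-inj = Balanced.cut (balanced s ρ ρ-inj)

-- Treewidth of the product

does-true⇒ : ∀ {P : Set} (d : Dec P) → does d ≡ true → P
does-true⇒ (yes p) _ = p

last : ℕ → ℕ
last zero    = 0
last (suc r) = 3 * suc (last r)

-- The apex gets the largest index because tree decompositions number a parent after its children;
-- the three subtrees occupy consecutive blocks.
encode : ∀ {r} → Node r → Fin (suc (last r))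
encode {r} apex    = fromℕ (last r)
encode (child i x) = inject₁ (combine i (encode x))

decode : ∀ r → Fin (suc (last r)) → Node r
decode zero    _ = apex
decode (suc r) t with view t
... | ‵fromℕ     = apex
... | ‵inject₁ u = child (proj₁ (remQuot {3} (suc (last r)) u)) (decode r (proj₂ (remQuot {3} (suc (last r)) u)))

decode-encode : ∀ {r} (x : Node r) → decode r (encode x) ≡ x
decode-encode {zero}  apex = refl
decode-encode {suc r} apex rewrite view-fromℕ (last (suc r)) = refl
decode-encode {suc r} (child i x)
  rewrite view-inject₁ (combine i (encode x)) =
  trans (cong (λ p → child (proj₁ p) (decode r (proj₂ p))) (Fin.remQuot-combine i (encode x)))
        (cong (child i) (decode-encode x))

encode-decode : ∀ r t → encode (decode r t) ≡ t
encode-decode zero zero = refl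
encode-decode (suc r) t with view t
... | ‵fromℕ     = refl
... | ‵inject₁ u = cong inject₁ (trans (cong (combine (proj₁ (remQuot {3} (suc (last r)) u))) (encode-decode r _))
                     (Fin.combine-remQuot {3} (suc (last r)) u))

_≟ⁿ_ : ∀ {r} (x y : Node r) → Dec (x ≡ y)
x ≟ⁿ y = map′ (λ eq → trans (sym (decode-encode x)) (trans (cong (decode _) eq) (decode-encode y)))
              (cong encode) (encode x Fin.≟ encode y)

up-larger : ∀ {r} (x : Node r) → x ≢ apex → toℕ (encode x) < toℕ (encode (up x))
up-larger apex ne = contradiction refl ne
up-larger {suc r} (child i apex) _ = subst₂ _<_ (sym (Fin.toℕ-inject₁ _)) (sym (Fin.toℕ-fromℕ _)) (Fin.toℕ<n _)
up-larger {suc r} (child i x@(child j y)) _ = begin-strict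
  toℕ (inject₁ (combine i (encode x)))        ≡⟨ Fin.toℕ-inject₁ _ ⟩
  toℕ (combine i (encode x))                  ≡⟨ Fin.toℕ-combine i (encode x) ⟩
  suc (last r) * toℕ i + toℕ (encode x)       <⟨ +-monoʳ-< (suc (last r) * toℕ i) (up-larger x λ ()) ⟩
  suc (last r) * toℕ i + toℕ (encode (up x))  ≡⟨ Fin.toℕ-combine i (encode (up x)) ⟨
  toℕ (combine i (encode (up x)))             ≡⟨ Fin.toℕ-inject₁ _ ⟨
  toℕ (inject₁ (combine i (encode (up x))))   ∎
  where open ≤-Reasoning

-- A leaf of the tree is its own junk child, and the last point of the path is fixed by `next`; thus
-- every vertex has exactly six neighbour candidates.
down : ∀ {r} → Node r → Fin 3 → Node r
down {zero}  apex        i = apex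
down {suc r} apex        i = child i apex
down {suc r} (child j x) i = child j (down x i)

down-up : ∀ {r} i (y : Node r) → ∃ λ h → down (up (child i y)) h ≡ child i y
down-up i apex        = i , refl
down-up i (child j y) with h , eq ← down-up j y = h , cong (child i) eq

next : ∀ {k} → Fin k → Fin k
next {suc zero}    zero    = zero
next {suc (suc k)} zero    = suc zero
next {suc k}       (suc j) = suc (next j)

next-inject₁ : ∀ {k} (j : Fin k) → next (inject₁ j) ≡ suc j
next-inject₁ zero    = refl
next-inject₁ (suc j) = cong suc (next-inject₁ j)

step⇒≢-next : ∀ {k} (i j : Fin k) → i ≢ j → pred j ≡ i → next i ≡ j
step⇒≢-next _ zero    i≢j refl = contradiction refl i≢j
step⇒≢-next _ (suc j) i≢j refl = next-inject₁ j

toSubset : ∀ {n} → List (Fin n) → Subset n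
toSubset = foldr (λ y s → ⁅ y ⁆ ∪ s) ∅

∈-toSubset⁺ : ∀ {n} {x : Fin n} {ys} → x ∈ ys → x ∈ˢ toSubset ys
∈-toSubset⁺ {x = x} (here refl) = x∈p∪q⁺ (inj₁ (x∈⁅x⁆ x))
∈-toSubset⁺ (there i)           = x∈p∪q⁺ (inj₂ (∈-toSubset⁺ i))

∈-toSubset⁻ : ∀ {n} {x : Fin n} ys → x ∈ˢ toSubset ys → x ∈ ys
∈-toSubset⁻ []       i = contradiction i ∉⊥
∈-toSubset⁻ (y ∷ ys) i = [ here ∘ x∈⁅y⁆⇒x≡y y , there ∘ ∈-toSubset⁻ ys ]′ (x∈p∪q⁻ ⁅ y ⁆ (toSubset ys) i)

∣p∪q∣≤∣p∣+∣q∣ : ∀ {n} (p q : Subset n) → ∣ p ∪ q ∣ ≤ ∣ p ∣ + ∣ q ∣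
∣p∪q∣≤∣p∣+∣q∣ []            []            = z≤n
∣p∪q∣≤∣p∣+∣q∣ (outside ∷ p) (outside ∷ q) = ∣p∪q∣≤∣p∣+∣q∣ p q
∣p∪q∣≤∣p∣+∣q∣ (outside ∷ p) (inside  ∷ q) = ≤-trans (s≤s (∣p∪q∣≤∣p∣+∣q∣ p q)) (≤-reflexive (sym (+-suc ∣ p ∣ ∣ q ∣)))
∣p∪q∣≤∣p∣+∣q∣ (inside  ∷ p) (outside ∷ q) = s≤s (∣p∪q∣≤∣p∣+∣q∣ p q)
∣p∪q∣≤∣p∣+∣q∣ (inside  ∷ p) (inside  ∷ q) = s≤s (≤-trans (∣p∪q∣≤∣p∣+∣q∣ p q) (+-monoʳ-≤ ∣ p ∣ (n≤1+n ∣ q ∣)))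

∣toSubset∣≤length : ∀ {n} (ys : List (Fin n)) → ∣ toSubset ys ∣ ≤ length ys
∣toSubset∣≤length {n} []       = ≤-reflexive (∣⊥∣≡0 n)
∣toSubset∣≤length     (y ∷ ys) = ≤-trans (∣p∪q∣≤∣p∣+∣q∣ ⁅ y ⁆ (toSubset ys))
  (+-mono-≤ (≤-reflexive (∣⁅x⁆∣≡1 y)) (∣toSubset∣≤length ys))

module Grid (r K : ℕ) where

  order : ℕ
  order = suc (last r) * K

  V : Set
  V = Vertex {K} r

  index : V → Fin order
  index (x , j) = combine (encode x) j

  vertex : Fin order → V
  vertex w = decode r (proj₁ (remQuot {suc (last r)} K w)) , proj₂ (remQuot {suc (last r)} K w)

  vertex-index : ∀ v → vertex (index v) ≡ v
  vertex-index (x , j) =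
    trans (cong (λ p → decode r (proj₁ p) , proj₂ p) (Fin.remQuot-combine (encode x) j))
          (cong (_, j) (decode-encode x))

  index-vertex : ∀ w → index (vertex w) ≡ w
  index-vertex w = trans (cong (λ t → combine t (proj₂ (remQuot {suc (last r)} K w))) (encode-decode r _))
                     (Fin.combine-remQuot {suc (last r)} K w)

  index-injective : Injective _≡_ _≡_ index
  index-injective {u} {v} eq = trans (sym (vertex-index u)) (trans (cong vertex eq) (vertex-index v))

  step? : ∀ u v → Dec (Step {K} {r} u v)
  step? (x , j) (y , j′) = (up x ≟ⁿ y ×-dec j Fin.≟ j′) ⊎-dec (x ≟ⁿ y ×-dec pred j Fin.≟ j′)

  adjacent? : ∀ u v → Dec (Adjacent {K} {r} u v)
  adjacent? u v = ¬? (≡-dec _≟ⁿ_ Fin._≟_ u v) ×-dec (step? u v ⊎-dec step? v u)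

  adjacent-sym : ∀ {u v} → Adjacent {K} {r} u v → Adjacent v u
  adjacent-sym (ne , s) = ne ∘ sym , swap s

  grid : Graph order
  grid = record
    { adj    = λ u v → does (adjacent? (vertex u) (vertex v))
    ; sym    = λ u v → does-⇔ (mk⇔ adjacent-sym adjacent-sym) (adjacent? (vertex u) (vertex v)) (adjacent? (vertex v) (vertex u))
    ; irrefl = λ v → dec-false (adjacent? (vertex v) (vertex v)) λ { (ne , _) → ne refl }
    }

  adj⇒adjacent : ∀ {u v} → adj grid u v ≡ true → Adjacent (vertex u) (vertex v)
  adj⇒adjacent = does-true⇒ (adjacent? _ _)

  adjacent⇒adj : ∀ {u v} → Adjacent u v → adj grid (index u) (index v) ≡ true
  adjacent⇒adj {u} {v} a =
    dec-true (adjacent? _ _) (subst₂ Adjacent (sym (vertex-index u)) (sym (vertex-index v)) a)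

  grid-width : ∀ {T} → MatchingWidth (Adjacent {K} {r}) T → MatchingWidth (λ u v → adj grid u v ≡ true) T
  grid-width width ρ ρ-inj = record
    { threshold     = threshold
    ; matching      = map index² matching
    ; size-matching = ≤-trans size-matching (≤-reflexive (sym (length-map index² matching)))
    ; disjoint      = AllPairs.map⁺ (AllPairs.map (λ { (p , q) → p ∘ index-injective , q ∘ index-injective }) disjoint)
    ; crossing      = All.map⁺ (All.map (λ { (a , lt , ge) → adjacent⇒adj a , lt , ge }) crossing)
    }
    where
    index² : V × V → Fin order × Fin order
    index² (u , v) = index u , index v
    open CutMatching (width (ρ ∘ index) (index-injective ∘ ρ-inj))

  neighbours : V → List V
  neighbours (x , j) = (up x , j) ∷ (x , pred j) ∷ (x , next j) ∷ tabulate (λ i → down x i , j)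

  neighbours-complete : ∀ {u v} → Adjacent u v → v ∈ neighbours u
  neighbours-complete (_ , inj₁ (inj₁ (refl , refl))) = here refl
  neighbours-complete (_ , inj₁ (inj₂ (refl , refl))) = there (here refl)
  neighbours-complete {x , i} {_ , j} (ne , inj₂ (inj₂ (refl , eq))) =
    there (there (here (cong (x ,_) (sym (step⇒≢-next i j (ne ∘ cong (x ,_)) eq)))))
  neighbours-complete {v = apex , j} (ne , inj₂ (inj₁ (refl , refl))) = contradiction refl ne
  neighbours-complete {x , j} {child i y , j} (ne , inj₂ (inj₁ (refl , refl))) with down-up i y
  ... | h , eq = there (there (there
    (subst (_∈ tabulate (λ i → down x i , j)) (cong (_, j) eq) (∈-tabulate⁺ {f = λ i → down x i , j} h))))

  neighbourhoods : Neighbourhoods grid 6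
  neighbourhoods = record
    { candidates           = λ w → map index (neighbours (vertex w))
    ; length-candidates    = λ w → refl
    ; neighbour∈candidates = λ {u} {v} a →
        subst (_∈ map index (neighbours (vertex u))) (index-vertex v)
          (∈-map⁺ index (neighbours-complete (adj⇒adjacent a)))
    }

  column : Node r → List (Fin order)
  column x = tabulate (λ j → index (x , j))

  columns : Node r → List (Fin order)
  columns x = column x ++ column (up x)

  length-columns : ∀ x → length (columns x) ≡ K + K
  length-columns x = trans (length-++ (column x)) (cong₂ _+_ (length-tabulate {n = K} _) (length-tabulate {n = K} _))

  ∈-column⁺ : ∀ w → w ∈ column (proj₁ (vertex w))
  ∈-column⁺ w = subst (_∈ column (proj₁ (vertex w))) (index-vertex w) (∈-tabulate⁺ (proj₂ (vertex w)))

  ∈-column⁻ : ∀ {w} x → w ∈ column x → proj₁ (vertex w) ≡ x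
  ∈-column⁻ x i with j , refl ← ∈-tabulate⁻ i = cong proj₁ (vertex-index (x , j))

  node : Fin (suc (last r)) → Node r
  node = decode r

  treeParent : Fin (last r) → Fin (suc (last r))
  treeParent l = encode (up (node (inject₁ l)))

  bagOf : Fin (suc (last r)) → Subset order
  bagOf t = toSubset (columns (node t))

  own-column : ∀ w {t} → proj₁ (vertex w) ≡ node t → w ∈ˢ bagOf t
  own-column w eq = ∈-toSubset⁺ (∈-++⁺ˡ (subst (λ x → w ∈ column x) eq (∈-column⁺ w)))

  parent-column : ∀ w {t} → proj₁ (vertex w) ≡ up (node t) → w ∈ˢ bagOf t
  parent-column w {t} eq = ∈-toSubset⁺ (∈-++⁺ʳ (column (node t)) (subst (λ x → w ∈ column x) eq (∈-column⁺ w)))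

  home : Fin order → Fin (suc (last r))
  home w = encode (proj₁ (vertex w))

  in-home : ∀ w → w ∈ˢ bagOf (home w)
  in-home w = own-column w (sym (decode-encode (proj₁ (vertex w))))

  -- The bags containing `w` form a star around its home, so any two of them are joined by a walk
  -- through the centre.
  near-home : ∀ w {t} → w ∈ˢ bagOf t → t ≡ home w ⊎ TreeAdj treeParent t (home w)
  near-home w {t} i with ∈-++⁻ (column (node t)) (∈-toSubset⁻ (columns (node t)) i)
  ... | inj₁ i′ = inj₁ (trans (sym (encode-decode r t)) (cong encode (sym (∈-column⁻ (node t) i′))))
  ... | inj₂ i′ with view t
  ...   | ‵inject₁ l = inj₂ (inj₁ (l , refl , cong encode (sym (∈-column⁻ (up (node (inject₁ l))) i′))))
  -- At the root the parent column is the root's own column, since `up apex` is `apex`.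
  ...   | ‵fromℕ     = inj₁ (cong encode (sym
                     (trans (∈-column⁻ (up (node (fromℕ (last r)))) i′) (cong up (decode-encode {r} apex)))))

  decomposition : TreeDecomposition grid
  decomposition = record
    { m              = last r
    ; parent         = treeParent
    ; parent-up      = λ l → subst (λ t → toℕ t < toℕ (treeParent l)) (encode-decode r (inject₁ l))
                               (up-larger (node (inject₁ l)) (not-apex l))
    ; bag            = bagOf
    ; vertex-covered = λ w → home w , in-home w
    ; edge-covered   = λ u v a → edge-in-bag u v (proj₂ (adj⇒adjacent a))
    ; connected      = λ w t t′ i i′ → walk w (near-home w i) (near-home w i′) i′
    }
    where
    not-apex : ∀ l → node (inject₁ l) ≢ apex
    not-apex l eq = Fin.fromℕ≢inject₁ (trans (cong encode (sym eq)) (encode-decode r (inject₁ l)))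

    step-in-bag : ∀ u v → Step (vertex u) (vertex v) → v ∈ˢ bagOf (home u)
    step-in-bag u v (inj₁ (eq , _)) = parent-column v (trans (sym eq) (cong up (sym (decode-encode _))))
    step-in-bag u v (inj₂ (eq , _)) = own-column v (trans (sym eq) (sym (decode-encode _)))

    edge-in-bag : ∀ u v → Step (vertex u) (vertex v) ⊎ Step (vertex v) (vertex u) →
                  Σ (Fin (suc (last r))) λ t → u ∈ˢ bagOf t × v ∈ˢ bagOf t
    edge-in-bag u v (inj₁ s) = home u , in-home u , step-in-bag u v s
    edge-in-bag u v (inj₂ s) = home v , step-in-bag v u s , in-home v

    walk : ∀ w {t t′} → t ≡ home w ⊎ TreeAdj treeParent t (home w) → t′ ≡ home w ⊎ TreeAdj treeParent t′ (home w) →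
           w ∈ˢ bagOf t′ → TreeWalk treeParent (λ x → w ∈ˢ bagOf x) t t′
    walk w (inj₁ refl) (inj₁ refl) _  = here
    walk w (inj₁ refl) (inj₂ a′)   i′ = step (swap a′) i′ here
    walk w (inj₂ a)    (inj₁ refl) i′ = step a i′ here
    walk w (inj₂ a)    (inj₂ a′)   i′ = step a (in-home w) (step (swap a′) i′ here)

  treewidth : ∀ {k} → K + K ≤ suc k → TreewidthAtMost grid k
  treewidth le = decomposition , λ t →
    ≤-trans (∣toSubset∣≤length (columns (node t))) (≤-trans (≤-reflexive (length-columns (node t))) le)

  adjacent⇒neighbour : (∀ v → ∃ (Adjacent v)) → NoIsolatedVertices grid
  adjacent⇒neighbour next w with u , a ← next (vertex w) =
    index u , subst (λ w → adj grid w (index u) ≡ true) (index-vertex w) (adjacent⇒adj a)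

no-isolated : ∀ r κ → NoIsolatedVertices (Grid.grid r (2 + κ))
no-isolated r κ = Grid.adjacent⇒neighbour r (2 + κ) λ
  { (x , zero)  → (x , suc zero) , (λ ()) , inj₂ (inj₂ (refl , refl))
  ; (x , suc j) → (x , inject₁ j) , (λ eq → suc≢inject₁ j (cong proj₂ eq)) , inj₁ (inj₂ (refl , refl)) }
  where
  suc≢inject₁ : ∀ {n} (j : Fin n) → suc j ≢ inject₁ j
  suc≢inject₁ j eq = 1+n≢n (trans (cong toℕ eq) (Fin.toℕ-inject₁ j))

-- Numerical estimates and the choice of parameters

half : ∀ k → ∃ λ κ → (2 + κ) + (2 + κ) ≤ 4 + k × 4 + k ≤ suc ((2 + κ) + (2 + κ))
half 0 = 0 , ≤-refl , n≤1+n _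
half 1 = 0 , n≤1+n _ , ≤-refl
half (suc (suc k)) with κ , lo , hi ← half k =
  suc κ , ≤-trans (≤-reflexive (double κ)) (s≤s (s≤s lo)) , ≤-trans (s≤s (s≤s hi)) (≤-reflexive (cong suc (sym (double κ))))
  where
  double : ∀ κ → (3 + κ) + (3 + κ) ≡ 2 + ((2 + κ) + (2 + κ))
  double = solve-∀

last-lower : ∀ r → r ≤ last r
last-lower zero    = z≤n
last-lower (suc r) = ≤-trans (s≤s (last-lower r)) (m≤m+n (suc (last r)) _)

last-upper : ∀ r → suc (last r) ≤ 2 ^ (2 * r)
last-upper zero    = ≤-refl
last-upper (suc r) = begin
  suc (3 * suc (last r))               ≤⟨ +-monoˡ-≤ (3 * suc (last r)) (s≤s (z≤n {last r})) ⟩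
  suc (last r) + 3 * suc (last r)      ≡⟨⟩
  4 * suc (last r)                     ≤⟨ *-monoʳ-≤ 4 (last-upper r) ⟩
  4 * 2 ^ (2 * r)                      ≡⟨ ^-distribˡ-+-* 2 2 (2 * r) ⟨
  2 ^ (2 + 2 * r)                      ≡⟨ cong (2 ^_) (*-suc 2 r) ⟨
  2 ^ (2 * suc r)                      ∎
  where open ≤-Reasoning

n≤2^n : ∀ n → n ≤ 2 ^ n
n≤2^n zero    = z≤n
n≤2^n (suc n) = begin
  suc n            ≤⟨ +-mono-≤ (m^n>0 2 n) (n≤2^n n) ⟩
  2 ^ n + 2 ^ n    ≡⟨ cong (2 ^ n +_) (+-identityʳ (2 ^ n)) ⟨
  2 ^ suc n        ∎
  where open ≤-Reasoning

order-upper : ∀ r {K} → K ≤ r → suc (last r) * K ≤ 2 ^ (3 * r)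
order-upper r {K} K≤r = begin
  suc (last r) * K        ≤⟨ *-mono-≤ (last-upper r) (≤-trans K≤r (n≤2^n r)) ⟩
  2 ^ (2 * r) * 2 ^ r     ≡⟨ ^-distribˡ-+-* 2 (2 * r) r ⟨
  2 ^ (2 * r + r)         ≡⟨ cong (2 ^_) (eq r) ⟩
  2 ^ (3 * r)             ∎
  where
  open ≤-Reasoning
  eq : ∀ r → 2 * r + r ≡ 3 * r
  eq = solve-∀

^-distribʳ-* : ∀ m a b → (a * b) ^ m ≡ a ^ m * b ^ m
^-distribʳ-* zero    a b = refl
^-distribʳ-* (suc m) a b = trans (cong (a * b *_) (^-distribʳ-* m a b)) (interchange a b (a ^ m) (b ^ m))
  where
  interchange : ∀ a b c d → a * b * (c * d) ≡ a * c * (b * d)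
  interchange = solve-∀

-- The `m`-th power of the gap gives `2 ^ m * b ^ (e * m) ≤ a ^ (e * m)`, and then the power of `b`
-- cancels.
power-gap : ∀ a b e m s .{{_ : NonZero b}} → 2 * b ^ e ≤ a ^ e → a ^ (e * m) ≤ s * b ^ (e * m) → 2 ^ m ≤ s
power-gap a b e m s gap le = *-cancelʳ-≤ (2 ^ m) s (b ^ (e * m)) {{m^n≢0 b (e * m)}} (begin
  2 ^ m * b ^ (e * m)    ≡⟨ cong (2 ^ m *_) (^-*-assoc b e m) ⟨
  2 ^ m * (b ^ e) ^ m    ≡⟨ ^-distribʳ-* m 2 (b ^ e) ⟨
  (2 * b ^ e) ^ m        ≤⟨ ^-monoˡ-≤ m gap ⟩
  (a ^ e) ^ m            ≡⟨ ^-*-assoc a e m ⟩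
  a ^ (e * m)            ≤⟨ le ⟩
  s * b ^ (e * m)        ∎)
  where open ≤-Reasoning

-- Here `r` is at most `(C + 2) * ℓ` and `k` at most `3 * K`. The 9 combines the latter 3 with the
-- one in `2 ^ (3 * r)`.
size-bound : ∀ C {K ℓ k n s r} → K ≤ ℓ → 1 ≤ K → k ≤ suc (K + K) → r ≡ C * ℓ + (K + K) →
             n ≤ 2 ^ (3 * r) → 2 ^ (ℓ * K) ≤ s → n ^ k ≤ s ^ (9 * (C + 2))
size-bound C {K} {ℓ} {k} {n} {s} {r} K≤ℓ 1≤K k≤ refl n≤ s≥ = begin
  n ^ k                                     ≤⟨ ^-monoˡ-≤ k n≤ ⟩
  (2 ^ (3 * r)) ^ k                         ≡⟨ ^-*-assoc 2 (3 * r) k ⟩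
  2 ^ (3 * r * k)                           ≤⟨ ^-monoʳ-≤ 2 (*-mono-≤ (*-monoʳ-≤ 3 r≤) k≤3K) ⟩
  2 ^ (3 * (C * ℓ + (ℓ + ℓ)) * (K + K + K)) ≡⟨ cong (2 ^_) (eq C ℓ K) ⟩
  2 ^ (ℓ * K * (9 * (C + 2)))               ≡⟨ ^-*-assoc 2 (ℓ * K) (9 * (C + 2)) ⟨
  (2 ^ (ℓ * K)) ^ (9 * (C + 2))             ≤⟨ ^-monoˡ-≤ (9 * (C + 2)) s≥ ⟩
  s ^ (9 * (C + 2))                         ∎
  where
  open ≤-Reasoning
  r≤ : C * ℓ + (K + K) ≤ C * ℓ + (ℓ + ℓ)
  r≤ = +-monoʳ-≤ (C * ℓ) (+-mono-≤ K≤ℓ K≤ℓ)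
  k≤3K : k ≤ K + K + K
  k≤3K = ≤-trans k≤ (≤-trans (≤-reflexive (+-comm 1 (K + K))) (+-monoʳ-≤ (K + K) 1≤K))
  eq : ∀ C ℓ K → 3 * (C * ℓ + (ℓ + ℓ)) * (K + K + K) ≡ ℓ * K * (9 * (C + 2))
  eq = solve-∀

-- For `m = ℓ * K` and `p = 50` the left side is the matching size required, and the factor of `m`
-- on the right is the constant `C` of `lower-bound`.
width-bound : ∀ e p {m} → 1 ≤ m → 2 + (e * m * p + e * m * p) ≤ (2 + (e * p + e * p)) * m
width-bound e p {m} 1≤m = begin
  2 + (e * m * p + e * m * p)        ≤⟨ +-monoˡ-≤ (e * m * p + e * m * p) (*-monoʳ-≤ 2 1≤m) ⟩
  2 * m + (e * m * p + e * m * p)    ≡⟨ eq e p m ⟩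
  (2 + (e * p + e * p)) * m          ∎
  where
  open ≤-Reasoning
  eq : ∀ e p m → 2 * m + (e * m * p + e * m * p) ≡ (2 + (e * p + e * p)) * m
  eq = solve-∀

weaken-width : ∀ {V : Set} {Adj : V → V → Set} {T T′} → T′ ≤ T → MatchingWidth Adj T → MatchingWidth Adj T′
weaken-width T′≤T width ρ ρ-inj = record
  { threshold = threshold ; matching = matching ; size-matching = ≤-trans T′≤T size-matching
  ; disjoint = disjoint ; crossing = crossing }
  where open CutMatching (width ρ ρ-inj)

-- A vertex is missed by the random independent set with probability at most
-- 127/128, and e independent misses have probability at most 1/2; thinning a set
-- of vertices to make the misses independent costs a factor of 50 = 1 + 7².
lower-bound : ∀ e C → 2 * 127 ^ e ≤ 128 ^ e → C ≡ 2 + (e * 50 + e * 50) →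
  ∀ k → 4 ≤ k → ∀ N → Σ ℕ λ n → N ≤ n × Σ (Graph n) λ G →
    NoIsolatedVertices G × TreewidthAtMost G k ×
    (∀ (B : BP n) → RealizesΦ B G → n ^ k ≤ size B ^ (9 * (C + 2)))
lower-bound e C gap C≡ k@(suc (suc (suc (suc k′)))) (s≤s (s≤s (s≤s (s≤s z≤n)))) N
  with κ , 2K≤k , k≤2K+1 ← half k′ =
  order , N≤order , grid , no-isolated r κ , treewidth (m≤n⇒m≤1+n 2K≤k) , λ B real →
    size-bound C K≤ℓ (s≤s z≤n) k≤2K+1 refl (order-upper r K≤r)
      (power-gap 128 127 e (ℓ * K) (size B) gap (matching-width⇒large B real neighbourhoods (e * (ℓ * K)) width))
  where
  K = 2 + κ
  -- The summand `N` makes the graph large enough. The summand `K` keeps the `K + K` bottom levels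
  -- within `2 * ℓ`, comparable to the other `C * ℓ` levels.
  ℓ = K + N
  s = C * ℓ
  r = s + (K + K)
  open Grid r K
  K≤ℓ : K ≤ ℓ
  K≤ℓ = m≤m+n K N
  K≤r : K ≤ r
  K≤r = ≤-trans (m≤m+n K K) (m≤n+m (K + K) s)
  1≤C : 1 ≤ C
  1≤C = subst (1 ≤_) (sym C≡) (s≤s z≤n)
  N≤order : N ≤ order
  N≤order = begin
    N                   ≤⟨ m≤n+m N K ⟩
    ℓ                   ≡⟨ *-identityˡ ℓ ⟨
    1 * ℓ               ≤⟨ *-monoˡ-≤ ℓ 1≤C ⟩
    s                   ≤⟨ m≤m+n s (K + K) ⟩
    r                   ≤⟨ last-lower r ⟩
    last r              ≤⟨ n≤1+n (last r) ⟩
    suc (last r)        ≡⟨ *-identityʳ (suc (last r)) ⟨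
    suc (last r) * 1    ≤⟨ *-monoʳ-≤ (suc (last r)) (s≤s z≤n) ⟩
    suc (last r) * K    ∎
    where open ≤-Reasoning
  width : MatchingWidth (λ u v → adj grid u v ≡ true) (2 + (e * (ℓ * K) * 50 + e * (ℓ * K) * 50))
  width = weaken-width T≤ (grid-width (matching-width s))
    where
    T≤ : 2 + (e * (ℓ * K) * 50 + e * (ℓ * K) * 50) ≤ s * K
    T≤ = ≤-trans (width-bound e 50 (s≤s z≤n)) (≤-reflexive (trans (cong (_* (ℓ * K)) (sym C≡)) (sym (*-assoc C ℓ K))))

theorem1 : Σ ℕ λ c → 1 ≤ c ×
    (∀ (k : ℕ) → 50 ≤ k → ∀ (N : ℕ) →
    Σ ℕ λ n → N ≤ n × Σ (Graph n) λ G →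
    NoIsolatedVertices G × TreewidthAtMost G k ×
    (∀ (B : BP n) → RealizesΦ B G → n ^ k ≤ size B ^ c))
-- With `e = 127` the gap is Bernoulli's inequality for `(1 + 1/127) ^ 127`, here checked by
-- computation; `12702` is `2 + 127 * 100`.
theorem1 = 9 * (12702 + 2) , s≤s z≤n , λ k 50≤k →
  lower-bound 127 12702 (≤ᵇ⇒≤ _ _ tt) refl k (≤-trans (≤ᵇ⇒≤ 4 50 tt) 50≤k)
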